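{- Let $d$ be a positive integer, let $N$ be a $2\times 2$ (real symmetric) positive definite matrix with positive entries and let $\underline{\mu}=(\mu_1,\mu_2)\in\mathbb{R}^2_{>0}$. Then there exist a vector $\underline{v}_c\in\mathbb{R}^{d+1}$ and a number $R_c(N,\underline{\mu})\in\mathbb{R}_{>0}$ such that for every $d$-regular graph $G$ we have $Z_G(N,\underline{\mu})=F_G(\underline{v}_c)$ and all complex zeros of the polynomial $F_G(\underline{v}_c|z)$ (in $z$) lie on the circle around $0$ of radius $R_c(N,\underline{\mu})$. Moreover, $R=R_c(N,\underline{\mu})$ is a positive real solution of $$(N_{11}N_{22}-N_{12}^2)R^4+(-N_{22}^2T+2N_{12}^2-N_{11}^2T^{ -1})R^2+(N_{11}N_{22}-N_{12}^2)=0,$$ where $T=\left(\frac{\mu_2}{\mu_1}\right)^{2/d}$.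
   Context: Graphs are finite. For a graph $G=(V,E)$, a symmetric $r\times r$ matrix $N$ and $\underline{\mu}\in\mathbb{R}^r$, $$Z_G(N,\underline{\mu})=\sum_{\sigma:V\to\{1,\dots,r\}}\prod_{v\in V}\mu_{\sigma(v)}\prod_{(u,v)\in E}N_{\sigma(u),\sigma(v)}.$$ For a $d$-regular graph $G=(V,E)$ and $(x_0,\dots,x_d)\in\mathbb{R}^{d+1}$, the subgraph counting polynomial is $$F_G(x_0,\dots,x_d)=\sum_{A\subseteq E}\prod_{v\in V}x_{d_A(v)},\qquad F_G(x_0,\dots,x_d|z)=\sum_{A\subseteq E}\left(\prod_{v\in V}x_{d_A(v)}\right)z^{2|A|},$$ where $d_A(v)$ is the number of edges of $A$ incident to $v$. -}

module Defs where

open import Algebra.Bundles.Raw using (RawRing)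
import Algebra.Definitions.RawSemiring as RawSemiringOps
open import Data.Bool.Base using (_∨_)
open import Data.Fin.Base as Fin using (Fin; fromℕ<)
import Data.Fin.Properties as Fin
open import Data.Fin.Subset using (Subset; inside; outside; _∩_; ∣_∣)
open import Data.Fin.Subset.Properties using (∣p∩q∣≤∣q∣)
open import Data.List.Base using (List; []; _∷_; foldr; allFin)
open import Data.Nat.Base as ℕ using (ℕ; zero; suc; s≤s)
import Data.Nat.Properties as ℕ
open import Data.Product.Base using (Σ; ∃; _×_; _,_; proj₁; proj₂)
open import Data.Rational.Base as ℚ using (ℚ; 0ℚ; 1ℚ; ½)
import Data.Rational.Properties as ℚ
open import Data.Rational.Solver using (module +-*-Solver)
open import Data.Sum.Base using (_⊎_)
open import Data.Vec.Base using (Vec; []; _∷_; lookup; tabulate)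
open import Data.Vec.Functional using (Vector)
open import Function.Definitions using (Injective)
open import Level using (0ℓ)
open import Relation.Binary.PropositionalEquality
open import Relation.Nullary.Decidable using (does)

-- V = Fin order.  An edge is an unordered pair of distinct vertices, stored
-- with its smaller endpoint first; injectivity excludes repeated edges.
record Graph : Set where
  field
    order      : ℕ
    size       : ℕ
    edge       : Fin size → Fin order × Fin order
    increasing : ∀ e → proj₁ (edge e) Fin.< proj₂ (edge e)
    injective  : Injective _≡_ _≡_ edge

  incident : Fin order → Subset size
  incident v = tabulate λ e → does (v Fin.≟ proj₁ (edge e)) ∨ does (v Fin.≟ proj₂ (edge e))

  degreeIn : Subset size → Fin order → ℕ
  degreeIn A v = ∣ A ∩ incident v ∣

  degree : Fin order → ℕ
  degree v = ∣ incident v ∣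

Regular : ℕ → Graph → Set
Regular d G = ∀ v → Graph.degree G v ≡ d

degreeIn≤d : ∀ {d} (G : Graph) → Regular d G → ∀ A v → Graph.degreeIn G A v ℕ.≤ d
degreeIn≤d G reg A v = subst (Graph.degreeIn G A v ℕ.≤_) (reg v) (∣p∩q∣≤∣q∣ A (Graph.incident G v))

module GraphPolynomials {c ℓ} (R : RawRing c ℓ) where

  open RawRing R
  open RawSemiringOps rawSemiring using (product; _^_)

  ∑-tuples : ∀ {A : Set} → List A → ∀ n → (Vec A n → Carrier) → Carrier
  ∑-tuples as zero    f = f []
  ∑-tuples as (suc n) f = foldr (λ a s → ∑-tuples as n (λ t → f (a ∷ t)) + s) 0# as

  -- σ : V → {1,…,r} is represented by the tuple of its values.
  Z : ∀ {r} (G : Graph) → (Fin r → Fin r → Carrier) → Vector Carrier r → Carrier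
  Z {r} G N μ = ∑-tuples (allFin r) order λ σ →
    product (λ v → μ (lookup σ v)) *
    product (λ e → N (lookup σ (proj₁ (edge e))) (lookup σ (proj₂ (edge e))))
    where open Graph G

  ∑-edgeSubsets : (G : Graph) → (Subset (Graph.size G) → Carrier) → Carrier
  ∑-edgeSubsets G = ∑-tuples (outside ∷ inside ∷ []) (Graph.size G)

  module _ {d} (G : Graph) (reg : Regular d G) (x : Vector Carrier (suc d)) where

    vertexWeights : Subset (Graph.size G) → Carrier
    vertexWeights A = product λ v → x (fromℕ< (s≤s (degreeIn≤d G reg A v)))

    F : Carrier
    F = ∑-edgeSubsets G vertexWeights

    F[z] : Carrier → Carrier
    F[z] z = ∑-edgeSubsets G λ A → vertexWeights A * z ^ (2 ℕ.* ∣ A ∣)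

-- ℝ is the setoid of Cauchy sequences of rationals, with termwise operations.
IsCauchy : (ℕ → ℚ) → Set
IsCauchy s = ∀ ε → 0ℚ ℚ.< ε →
  ∃ λ N → ∀ m n → N ℕ.≤ m → N ℕ.≤ n → ℚ.∣ s m ℚ.- s n ∣ ℚ.< ε

record ℝ : Set where
  constructor mkℝ
  field
    seq      : ℕ → ℚ
    isCauchy : IsCauchy seq

open ℝ

infix 4 _≈_ _<_ _#_

-- Two sequences denote the same real when their difference tends to 0; _≡_ on ℝ
-- is strictly finer.
record _≈_ (x y : ℝ) : Set where
  constructor mk≈
  field
    close : ∀ ε → 0ℚ ℚ.< ε → ∃ λ N → ∀ n → N ℕ.≤ n → ℚ.∣ seq x n ℚ.- seq y n ∣ ℚ.< ε

record _<_ (x y : ℝ) : Set where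
  constructor mk<
  field
    gap   : ℚ
    gap>0 : 0ℚ ℚ.< gap
    from  : ℕ
    below : ∀ n → from ℕ.≤ n → seq x n ℚ.+ gap ℚ.≤ seq y n

-- Apartness is the constructive form of x ≠ y; classically the two coincide.
_#_ : ℝ → ℝ → Set
x # y = x < y ⊎ y < x

private
  open ℚ.≤-Reasoning
  open +-*-Solver using (solve; _:=_; _:+_; _:*_; _:-_; :-_; con)

0<½ : 0ℚ ℚ.< ½
0<½ = ℚ.positive⁻¹ ½

*-pos : ∀ {p q} → 0ℚ ℚ.< p → 0ℚ ℚ.< q → 0ℚ ℚ.< p ℚ.* q
*-pos {p} {q} 0<p 0<q =
  ℚ.positive⁻¹ (p ℚ.* q) {{ℚ.pos*pos⇒pos p {{ℚ.positive 0<p}} q {{ℚ.positive 0<q}}}}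

recip : ∀ q → 0ℚ ℚ.< q → ℚ
recip q 0<q = (ℚ.1/ q) {{ℚ.>-nonZero 0<q}}

recip-inverse : ∀ q (0<q : 0ℚ ℚ.< q) → recip q 0<q ℚ.* q ≡ 1ℚ
recip-inverse q 0<q = ℚ.*-inverseˡ q {{ℚ.>-nonZero 0<q}}

0<recip : ∀ q (0<q : 0ℚ ℚ.< q) → 0ℚ ℚ.< recip q 0<q
0<recip q 0<q = ℚ.positive⁻¹ (recip q 0<q) {{ℚ.1/pos⇒pos q {{ℚ.positive 0<q}}}}

⊔-max : ∀ {a b m} → a ℕ.⊔ b ℕ.≤ m → (a ℕ.≤ m) × (b ℕ.≤ m)
⊔-max {a} {b} h = ℕ.≤-trans (ℕ.m≤m⊔n a b) h , ℕ.≤-trans (ℕ.m≤n⊔m a b) h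

eventualBound : ∀ {s} → IsCauchy s →
  ∃ λ B → ∃ λ N → (0ℚ ℚ.< B) × (∀ n → N ℕ.≤ n → ℚ.∣ s n ∣ ℚ.≤ B)
eventualBound {s} h with h 1ℚ (ℚ.positive⁻¹ 1ℚ)
... | N , close = ℚ.∣ s N ∣ ℚ.+ 1ℚ , N , 0<B , bound
  where
  0<B : 0ℚ ℚ.< ℚ.∣ s N ∣ ℚ.+ 1ℚ
  0<B = ℚ.+-mono-≤-< (ℚ.0≤∣p∣ (s N)) (ℚ.positive⁻¹ 1ℚ)
  bound : ∀ n → N ℕ.≤ n → ℚ.∣ s n ∣ ℚ.≤ ℚ.∣ s N ∣ ℚ.+ 1ℚ
  bound n N≤n = begin
    ℚ.∣ s n ∣
      ≡⟨ cong ℚ.∣_∣ (solve 2 (λ a b → a := b :+ (a :- b)) refl (s n) (s N)) ⟩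
    ℚ.∣ s N ℚ.+ (s n ℚ.- s N) ∣
      ≤⟨ ℚ.∣p+q∣≤∣p∣+∣q∣ (s N) (s n ℚ.- s N) ⟩
    ℚ.∣ s N ∣ ℚ.+ ℚ.∣ s n ℚ.- s N ∣
      ≤⟨ ℚ.+-monoʳ-≤ ℚ.∣ s N ∣ (ℚ.<⇒≤ (close n N N≤n ℕ.≤-refl)) ⟩
    ℚ.∣ s N ∣ ℚ.+ 1ℚ ∎

products-close : ∀ A B δ a b c e → 0ℚ ℚ.< A → 0ℚ ℚ.< B →
  ℚ.∣ a ∣ ℚ.≤ A → ℚ.∣ e ∣ ℚ.≤ B → ℚ.∣ b ℚ.- e ∣ ℚ.< δ → ℚ.∣ a ℚ.- c ∣ ℚ.< δ →
  ℚ.∣ a ℚ.* b ℚ.- c ℚ.* e ∣ ℚ.< (A ℚ.+ B) ℚ.* δ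
products-close A B δ a b c e 0<A 0<B a≤A e≤B b-e a-c = begin-strict
  ℚ.∣ a ℚ.* b ℚ.- c ℚ.* e ∣
    ≡⟨ cong ℚ.∣_∣ (solve 4 (λ a b c e → a :* b :- c :* e := a :* (b :- e) :+ (a :- c) :* e)
         refl a b c e) ⟩
  ℚ.∣ a ℚ.* (b ℚ.- e) ℚ.+ (a ℚ.- c) ℚ.* e ∣
    ≤⟨ ℚ.∣p+q∣≤∣p∣+∣q∣ (a ℚ.* (b ℚ.- e)) ((a ℚ.- c) ℚ.* e) ⟩
  ℚ.∣ a ℚ.* (b ℚ.- e) ∣ ℚ.+ ℚ.∣ (a ℚ.- c) ℚ.* e ∣
    ≡⟨ cong₂ ℚ._+_ (ℚ.∣p*q∣≡∣p∣*∣q∣ a (b ℚ.- e)) (ℚ.∣p*q∣≡∣p∣*∣q∣ (a ℚ.- c) e) ⟩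
  ℚ.∣ a ∣ ℚ.* ℚ.∣ b ℚ.- e ∣ ℚ.+ ℚ.∣ a ℚ.- c ∣ ℚ.* ℚ.∣ e ∣
    ≤⟨ ℚ.+-mono-≤
         (ℚ.*-monoʳ-≤-nonNeg ℚ.∣ b ℚ.- e ∣ {{ℚ.nonNegative (ℚ.0≤∣p∣ (b ℚ.- e))}} a≤A)
         (ℚ.*-monoˡ-≤-nonNeg ℚ.∣ a ℚ.- c ∣ {{ℚ.nonNegative (ℚ.0≤∣p∣ (a ℚ.- c))}} e≤B) ⟩
  A ℚ.* ℚ.∣ b ℚ.- e ∣ ℚ.+ ℚ.∣ a ℚ.- c ∣ ℚ.* B
    <⟨ ℚ.+-mono-<
         (ℚ.*-monoʳ-<-pos A {{ℚ.positive 0<A}} b-e)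
         (ℚ.*-monoˡ-<-pos B {{ℚ.positive 0<B}} a-c) ⟩
  A ℚ.* δ ℚ.+ δ ℚ.* B
    ≡⟨ solve 3 (λ a b e → a :* e :+ e :* b := (a :+ b) :* e) refl A B δ ⟩
  (A ℚ.+ B) ℚ.* δ ∎

recipScale : ∀ K → 0ℚ ℚ.< K → ∀ ε → 0ℚ ℚ.< ε → ∃ λ δ → (0ℚ ℚ.< δ) × (K ℚ.* δ ≡ ε)
recipScale K 0<K ε 0<ε = r ℚ.* ε , *-pos (0<recip K 0<K) 0<ε ,
  trans (sym (ℚ.*-assoc K r ε))
    (trans (cong (ℚ._* ε) (trans (ℚ.*-comm K r) (recip-inverse K 0<K))) (ℚ.*-identityˡ ε))
  where
  r : ℚ
  r = recip K 0<K

recips-close : ∀ c ε a b p q → 0ℚ ℚ.< ε → 0ℚ ℚ.< c → 0ℚ ℚ.< a → 0ℚ ℚ.< b →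
  a ℚ.* p ≡ 1ℚ → b ℚ.* q ≡ 1ℚ → c ℚ.≤ p → c ℚ.≤ q →
  ℚ.∣ q ℚ.- p ∣ ℚ.< ε ℚ.* (c ℚ.* c) → ℚ.∣ a ℚ.- b ∣ ℚ.< ε
recips-close c ε a b p q 0<ε 0<c 0<a 0<b ap≡1 bq≡1 c≤p c≤q q-p = begin-strict
  ℚ.∣ a ℚ.- b ∣
    ≡⟨ cong ℚ.∣_∣ difference ⟩
  ℚ.∣ (a ℚ.* b) ℚ.* (q ℚ.- p) ∣
    ≡⟨ ℚ.∣p*q∣≡∣p∣*∣q∣ (a ℚ.* b) (q ℚ.- p) ⟩
  ℚ.∣ a ℚ.* b ∣ ℚ.* ℚ.∣ q ℚ.- p ∣
    ≡⟨ cong (ℚ._* ℚ.∣ q ℚ.- p ∣) (ℚ.0≤p⇒∣p∣≡p (ℚ.<⇒≤ 0<ab)) ⟩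
  (a ℚ.* b) ℚ.* ℚ.∣ q ℚ.- p ∣
    <⟨ ℚ.*-monoʳ-<-pos (a ℚ.* b) {{ℚ.positive 0<ab}} q-p ⟩
  (a ℚ.* b) ℚ.* (ε ℚ.* (c ℚ.* c))
    ≡⟨ solve 4 (λ a b e f → (a :* b) :* (e :* (f :* f)) := (e :* (a :* f)) :* (b :* f))
         refl a b ε c ⟩
  (ε ℚ.* (a ℚ.* c)) ℚ.* (b ℚ.* c)
    ≤⟨ ℚ.*-monoˡ-≤-nonNeg (ε ℚ.* (a ℚ.* c))
         {{ℚ.nonNegative (ℚ.<⇒≤ (*-pos 0<ε (*-pos 0<a 0<c)))}} (times-c b q 0<b bq≡1 c≤q) ⟩
  (ε ℚ.* (a ℚ.* c)) ℚ.* 1ℚ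
    ≡⟨ ℚ.*-identityʳ (ε ℚ.* (a ℚ.* c)) ⟩
  ε ℚ.* (a ℚ.* c)
    ≤⟨ ℚ.*-monoˡ-≤-nonNeg ε {{ℚ.nonNegative (ℚ.<⇒≤ 0<ε)}} (times-c a p 0<a ap≡1 c≤p) ⟩
  ε ℚ.* 1ℚ
    ≡⟨ ℚ.*-identityʳ ε ⟩
  ε ∎
  where
  0<ab : 0ℚ ℚ.< a ℚ.* b
  0<ab = *-pos 0<a 0<b
  times-c : ∀ a p → 0ℚ ℚ.< a → a ℚ.* p ≡ 1ℚ → c ℚ.≤ p → a ℚ.* c ℚ.≤ 1ℚ
  times-c a p 0<a ap≡1 c≤p = subst (a ℚ.* c ℚ.≤_) ap≡1
    (ℚ.*-monoˡ-≤-nonNeg a {{ℚ.nonNegative (ℚ.<⇒≤ 0<a)}} c≤p)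
  difference : a ℚ.- b ≡ (a ℚ.* b) ℚ.* (q ℚ.- p)
  difference = sym (begin-equality
    (a ℚ.* b) ℚ.* (q ℚ.- p)
      ≡⟨ solve 4 (λ a b e f → (a :* b) :* (f :- e) := a :* (b :* f) :- b :* (a :* e))
           refl a b p q ⟩
    a ℚ.* (b ℚ.* q) ℚ.- b ℚ.* (a ℚ.* p)
      ≡⟨ cong₂ (λ x y → a ℚ.* x ℚ.- b ℚ.* y) bq≡1 ap≡1 ⟩
    a ℚ.* 1ℚ ℚ.- b ℚ.* 1ℚ
      ≡⟨ cong₂ ℚ._-_ (ℚ.*-identityʳ a) (ℚ.*-identityʳ b) ⟩
    a ℚ.- b ∎)

abstract
  const-cauchy : ∀ q → IsCauchy (λ _ → q)
  const-cauchy q ε 0<ε = 0 , λ _ _ _ _ →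
    subst (λ t → ℚ.∣ t ∣ ℚ.< ε) (sym (ℚ.+-inverseʳ q)) 0<ε

  +-cauchy : ∀ s t → IsCauchy s → IsCauchy t → IsCauchy (λ n → s n ℚ.+ t n)
  +-cauchy s t hs ht ε 0<ε
    with hs (ε ℚ.* ½) (*-pos 0<ε 0<½) | ht (ε ℚ.* ½) (*-pos 0<ε 0<½)
  ... | M , hM | N , hN = M ℕ.⊔ N , λ m n h k →
    let M≤m , N≤m = ⊔-max h
        M≤n , N≤n = ⊔-max k
    in begin-strict
      ℚ.∣ (s m ℚ.+ t m) ℚ.- (s n ℚ.+ t n) ∣
        ≡⟨ cong ℚ.∣_∣ (solve 4 (λ a b c e → (a :+ b) :- (c :+ e) := (a :- c) :+ (b :- e))
             refl (s m) (t m) (s n) (t n)) ⟩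
      ℚ.∣ (s m ℚ.- s n) ℚ.+ (t m ℚ.- t n) ∣
        ≤⟨ ℚ.∣p+q∣≤∣p∣+∣q∣ (s m ℚ.- s n) (t m ℚ.- t n) ⟩
      ℚ.∣ s m ℚ.- s n ∣ ℚ.+ ℚ.∣ t m ℚ.- t n ∣
        <⟨ ℚ.+-mono-< (hM m n M≤m M≤n) (hN m n N≤m N≤n) ⟩
      ε ℚ.* ½ ℚ.+ ε ℚ.* ½
        ≡⟨ solve 1 (λ e → e :* con ½ :+ e :* con ½ := e) refl ε ⟩
      ε ∎

  neg-cauchy : ∀ s → IsCauchy s → IsCauchy (λ n → ℚ.- s n)
  neg-cauchy s hs ε 0<ε with hs ε 0<ε
  ... | N , hN = N , λ m n h k → begin-strict
      ℚ.∣ (ℚ.- s m) ℚ.- (ℚ.- s n) ∣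
        ≡⟨ cong ℚ.∣_∣ (solve 2 (λ a b → (:- a) :- (:- b) := b :- a) refl (s m) (s n)) ⟩
      ℚ.∣ s n ℚ.- s m ∣
        <⟨ hN n m k h ⟩
      ε ∎

  *-cauchy : ∀ s t → IsCauchy s → IsCauchy t → IsCauchy (λ n → s n ℚ.* t n)
  *-cauchy s t hs ht ε 0<ε =
    let A , N₁ , 0<A , hA = eventualBound hs
        B , N₂ , 0<B , hB = eventualBound ht
        δ , 0<δ , scale   = recipScale (A ℚ.+ B) (ℚ.+-mono-< 0<A 0<B) ε 0<ε
        N₃ , hs′          = hs δ 0<δ
        N₄ , ht′          = ht δ 0<δ
    in (N₁ ℕ.⊔ N₂) ℕ.⊔ (N₃ ℕ.⊔ N₄) , λ m n h k →
    let h₁₂ , h₃₄ = ⊔-max {N₁ ℕ.⊔ N₂} h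
        k₁₂ , k₃₄ = ⊔-max {N₁ ℕ.⊔ N₂} k
        N₃≤m , N₄≤m = ⊔-max {N₃} h₃₄
        N₃≤n , N₄≤n = ⊔-max {N₃} k₃₄
    in subst (ℚ.∣ s m ℚ.* t m ℚ.- s n ℚ.* t n ∣ ℚ.<_) scale
         (products-close A B δ (s m) (t m) (s n) (t n) 0<A 0<B
           (hA m (proj₁ (⊔-max {N₁} h₁₂))) (hB n (proj₂ (⊔-max {N₁} k₁₂)))
           (ht′ m n N₄≤m N₄≤n) (hs′ m n N₃≤m N₃≤n))

infix  8 -_
infixl 7 _*_
infixl 6 _+_ _-_

fromℚ : ℚ → ℝ
fromℚ q = mkℝ (λ _ → q) (const-cauchy q)

0ℝ 1ℝ 2ℝ : ℝ
0ℝ = fromℚ 0ℚ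
1ℝ = fromℚ 1ℚ
2ℝ = fromℚ (1ℚ ℚ.+ 1ℚ)

_+_ _*_ : ℝ → ℝ → ℝ
x + y = mkℝ (λ n → seq x n ℚ.+ seq y n) (+-cauchy (seq x) (seq y) (isCauchy x) (isCauchy y))
x * y = mkℝ (λ n → seq x n ℚ.* seq y n) (*-cauchy (seq x) (seq y) (isCauchy x) (isCauchy y))

-_ : ℝ → ℝ
- x = mkℝ (λ n → ℚ.- seq x n) (neg-cauchy (seq x) (isCauchy x))

_-_ : ℝ → ℝ → ℝ
x - y = x + (- y)

-- The maximum with c makes every term invertible; eventually it has no effect.
recipSeq : (ℕ → ℚ) → ∀ c → 0ℚ ℚ.< c → ℕ → ℚ
recipSeq s c 0<c n = recip (s n ℚ.⊔ c) (ℚ.<-≤-trans 0<c (ℚ.p≤q⊔p (s n) c))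

abstract
  recip-cauchy : ∀ s c (0<c : 0ℚ ℚ.< c) N → IsCauchy s →
                 (∀ n → N ℕ.≤ n → 0ℚ ℚ.+ c ℚ.≤ s n) → IsCauchy (recipSeq s c 0<c)
  recip-cauchy s c 0<c N hs below ε 0<ε with hs (ε ℚ.* (c ℚ.* c)) (*-pos 0<ε (*-pos 0<c 0<c))
  ... | M , hM = M ℕ.⊔ N , λ m n h k →
    let M≤m , N≤m = ⊔-max {M} h
        M≤n , N≤n = ⊔-max {M} k
    in recips-close c ε (u m) (u n) (p m) (p n) 0<ε 0<c
         (0<recip (p m) (0<p m)) (0<recip (p n) (0<p n))
         (recip-inverse (p m) (0<p m)) (recip-inverse (p n) (0<p n))
         (ℚ.p≤q⊔p (s m) c) (ℚ.p≤q⊔p (s n) c)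
         (subst₂ (λ x y → ℚ.∣ x ℚ.- y ∣ ℚ.< ε ℚ.* (c ℚ.* c)) (sym (p≡s n N≤n)) (sym (p≡s m N≤m))
           (hM n m M≤n M≤m))
    where
    u p : ℕ → ℚ
    u = recipSeq s c 0<c
    p n = s n ℚ.⊔ c
    0<p : ∀ n → 0ℚ ℚ.< p n
    0<p n = ℚ.<-≤-trans 0<c (ℚ.p≤q⊔p (s n) c)
    p≡s : ∀ n → N ℕ.≤ n → p n ≡ s n
    p≡s n N≤n = ℚ.p≥q⇒p⊔q≡p (subst (ℚ._≤ s n) (ℚ.+-identityˡ c) (below n N≤n))

inv : (x : ℝ) → 0ℝ < x → ℝ
inv x (mk< c 0<c N below) =
  mkℝ (recipSeq (seq x) c 0<c) (recip-cauchy (seq x) c 0<c N (isCauchy x) below)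

ℝ-rawRing : RawRing 0ℓ 0ℓ
ℝ-rawRing = record
  { Carrier = ℝ ; _≈_ = _≈_ ; _+_ = _+_ ; _*_ = _*_ ; -_ = -_ ; 0# = 0ℝ ; 1# = 1ℝ }

open RawSemiringOps (RawRing.rawSemiring ℝ-rawRing) public using (_^_; sum)

-- T = x^(p/q): for x > 0 and q ≥ 1 this is the unique T > 0 with T^q = x^p.
record _IsPower_[_/_] (T x : ℝ) (p q : ℕ) : Set where
  constructor isPower
  field
    power>0  : 0ℝ < T
    equation : T ^ q ≈ x ^ p

open _IsPower_[_/_] public using (power>0)

record ℂ : Set where
  constructor _+i_
  field
    re im : ℝ

open ℂ

infix 4 _≈ᶜ_

record _≈ᶜ_ (z w : ℂ) : Set where
  constructor mk≈ᶜ
  field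
    re≈ : re z ≈ re w
    im≈ : im z ≈ im w

fromℝ : ℝ → ℂ
fromℝ x = x +i 0ℝ

ℂ-rawRing : RawRing 0ℓ 0ℓ
ℂ-rawRing = record
  { Carrier = ℂ
  ; _≈_ = _≈ᶜ_
  ; _+_ = λ z w → (re z + re w) +i (im z + im w)
  ; _*_ = λ z w → (re z * re w - im z * im w) +i (re z * im w + im z * re w)
  ; -_  = λ z → (- re z) +i (- im z)
  ; 0#  = fromℝ 0ℝ
  ; 1#  = fromℝ 1ℝ
  }

-- |z| = R, squared to avoid the square root; meant for R > 0.
OnCircle : ℝ → ℂ → Set
OnCircle R z = re z ^ 2 + im z ^ 2 ≈ R ^ 2

Matrix : ℕ → Set
Matrix r = Fin r → Fin r → ℝ

Symmetric : ∀ {r} → Matrix r → Set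
Symmetric N = ∀ i j → N i j ≈ N j i

-- v ≠ 0 is read as: some coordinate is apart from 0.
PositiveDefinite : ∀ {r} → Matrix r → Set
PositiveDefinite {r} N = ∀ (v : Vector ℝ r) → (∃ λ i → v i # 0ℝ) →
  0ℝ < sum (λ i → sum (λ j → v i * N i j * v j))

open GraphPolynomials ℝ-rawRing public using (Z; F)

ZerosOnCircle : ∀ {d} (G : Graph) → Regular d G → Vector ℝ (suc d) → ℝ → Set
ZerosOnCircle G reg x R =
  ∀ z → GraphPolynomials.F[z] ℂ-rawRing G reg (λ k → fromℝ (x k)) z ≈ᶜ fromℝ 0ℝ → OnCircle R z

-- Write N = aaᵀ + bbᵀ with a, b ∈ ℝ².  Expanding the product over the edges gives Z_G(N, μ) = F_G(v) with
-- v_k = Σᵢ μᵢ aᵢ^(d−k) bᵢ^k.  There remains the freedom of rotating (a, b); for a suitable rotation and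
-- t = (μ₂/μ₁)^(1/d) one has a = (Rs, Rq/t), b = (q, s/t) with s > q > 0, so that
-- v_k = μ₁ R^(d−k) (s^(d−k) q^k + q^(d−k) s^k), and R solves the quartic equation.  Now F_G(v|z) is the
-- partition function of a two-state model on G with edge weights R² (s, q)(s, q)ᵀ + z² (q, s)(q, s)ᵀ.
--
-- This function is nonzero for |z| < R, by the Lee–Yang argument with Asano contraction: cutting all the
-- edges into half-edges h with variables x_h leaves a product over the vertices of
-- Π (s + q x_h) + Π (q + s x_h), which does not vanish for |x_h| < 1, and glueing two half-edges preserves
-- this property.  Exchanging the two states gives |z| > R.  Half-edge variables are written homogeneously as
-- (ξ : x), so that no complex division is needed.
--
-- Constructively, x ≤ y is used in the form ¬ y < x, which suffices since the order on ℝ is tight.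

module Submission where

open import Algebra.Bundles using (CommutativeMonoid; CommutativeRing; RawRing)
import Algebra.Definitions.RawSemiring as RawSemiringOps
import Algebra.Properties.CommutativeMonoid.Sum as Sum
import Algebra.Properties.CommutativeSemigroup as CommutativeSemigroupProperties
import Algebra.Properties.CommutativeSemiring.Exp as CommExp
import Algebra.Properties.Semiring.Exp as Exp
import Algebra.Properties.Semiring.Mult as Mult
import Algebra.Solver.Ring as RingSolver
open import Algebra.Solver.Ring.AlmostCommutativeRing
  using (fromCommutativeRing; _-Raw-AlmostCommutative⟶_)
open import Data.Bool.Base using (Bool; true; false; if_then_else_; _∨_)
open import Data.Empty using (⊥-elim)
open import Data.Fin.Base as Fin using (Fin; zero; suc; toℕ; fromℕ<)
open import Data.Fin.Patterns using (0F; 1F)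
import Data.Fin.Properties as Fin
open import Data.Fin.Subset using (Subset; inside; outside; _∩_; ∣_∣)
open import Data.Fin.Subset.Properties using (∣p∩q∣≤∣q∣)
open import Data.Integer.Base as ℤ using (+_)
import Data.Integer.Properties as ℤ
open import Data.List.Base using (List; []; _∷_; foldr; allFin)
open import Data.Maybe.Base using (Maybe; just; nothing)
open import Data.Nat.Base as ℕ using (ℕ; zero; suc; _∸_; NonZero)
import Data.Nat.Properties as ℕ
open import Data.Product.Base using (Σ; ∃; _×_; _,_; proj₁; proj₂)
open import Data.Rational.Base as ℚ using (ℚ; 0ℚ; 1ℚ; ½)
import Data.Rational.Properties as ℚ
open import Data.Rational.Solver using (module +-*-Solver)
import Data.Rational.Unnormalised.Base as ℚᵘ
import Data.Rational.Unnormalised.Properties as ℚᵘ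
open import Data.Sum.Base using (_⊎_; inj₁; inj₂; [_,_]′)
open import Data.Vec.Base using (Vec; []; _∷_; lookup)
open import Data.Vec.Functional using (Vector)
open import Data.Vec.Properties using (lookup∘tabulate)
open import Level using (0ℓ)
open import Relation.Binary.PropositionalEquality as ≡ using (_≡_; _≢_; cong; subst)
import Relation.Binary.Reasoning.Setoid as SetoidReasoning
open import Relation.Nullary using (¬_; yes; no; does; contradiction)
open import Defs using (Graph; Regular; degreeIn≤d; module GraphPolynomials)

-- Sums over tuples and edge subsets in a commutative ring

-- Asano contraction usually sets both half-edge variables equal and compares the outer coefficients
-- of the resulting quadratic with the product of its roots. Constructively this would need square
-- roots of complex numbers and a case distinction on the leading coefficient. Here nonvanishing
-- becomes an inequality between squared moduli instead: summing it over sign changes cancels the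
-- cross terms, summing it over the exchange of the two half-edges gives the middle coefficients a
-- favourable sign, and a bound on the outer coefficients remains. Roots are then needed only for
-- positive reals: for the root that equalises the two vertex weights, and for the explicit square
-- roots that produce the rotation in place of an angle.

module GraphExpansion {c ℓ} (R : CommutativeRing c ℓ) where

  open CommutativeRing R hiding (zero)
  open RawSemiringOps (RawRing.rawSemiring rawRing) using (product; _^_)
  open GraphPolynomials rawRing
  open SetoidReasoning setoid
  open Sum *-commutativeMonoid using ()
    renaming (sum-cong-≋ to product-cong; ∑-distrib-+ to product-*; ∑-comm to product-comm; sum-replicate-zero to product-1)
  open CommutativeSemigroupProperties *-commutativeSemigroup using ()
    renaming (interchange to *-interchange; x∙yz≈y∙xz to x*yz≈y*xz)
  open CommutativeSemigroupProperties
    (CommutativeMonoid.commutativeSemigroup +-commutativeMonoid)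
    using () renaming (interchange to +-interchange)

  private variable
    A B : Set

  -- This is the fold inside `∑-tuples`, so a sum over tuples of length `suc n` is definitionally a
  -- `∑-list` of sums over tuples of length `n`.
  ∑-list : List A → (A → Carrier) → Carrier
  ∑-list as f = foldr (λ a s → f a + s) 0# as

  ∑-list-cong : ∀ (as : List A) {f g} → (∀ a → f a ≈ g a) → ∑-list as f ≈ ∑-list as g
  ∑-list-cong []       f≈g = refl
  ∑-list-cong (a ∷ as) f≈g = +-cong (f≈g a) (∑-list-cong as f≈g)

  ∑-list-+ : ∀ (as : List A) f g → ∑-list as (λ a → f a + g a) ≈ ∑-list as f + ∑-list as g
  ∑-list-+ []       f g = sym (+-identityˡ 0#)
  ∑-list-+ (a ∷ as) f g = trans (+-congˡ (∑-list-+ as f g)) (+-interchange (f a) (g a) _ _)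

  ∑-list-0 : ∀ (as : List A) → ∑-list as (λ _ → 0#) ≈ 0#
  ∑-list-0 []       = refl
  ∑-list-0 (a ∷ as) = trans (+-identityˡ _) (∑-list-0 as)

  *-∑-list : ∀ (as : List A) x f → x * ∑-list as f ≈ ∑-list as (λ a → x * f a)
  *-∑-list []       x f = zeroʳ x
  *-∑-list (a ∷ as) x f = trans (distribˡ x _ _) (+-congˡ (*-∑-list as x f))

  ∑-tuples-cong : ∀ (as : List A) n {f g} → (∀ t → f t ≈ g t) → ∑-tuples as n f ≈ ∑-tuples as n g
  ∑-tuples-cong as zero    f≈g = f≈g []
  ∑-tuples-cong as (suc n) f≈g = ∑-list-cong as λ a → ∑-tuples-cong as n λ t → f≈g (a ∷ t)

  ∑-tuples-+ : ∀ (as : List A) n f g → ∑-tuples as n (λ t → f t + g t) ≈ ∑-tuples as n f + ∑-tuples as n g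
  ∑-tuples-+ as zero    f g = refl
  ∑-tuples-+ as (suc n) f g = trans (∑-list-cong as λ a → ∑-tuples-+ as n _ _) (∑-list-+ as _ _)

  ∑-tuples-0 : ∀ (as : List A) n → ∑-tuples as n (λ _ → 0#) ≈ 0#
  ∑-tuples-0 as zero    = refl
  ∑-tuples-0 as (suc n) = trans (∑-list-cong as λ a → ∑-tuples-0 as n) (∑-list-0 as)

  *-∑-tuples : ∀ (as : List A) n x f → x * ∑-tuples as n f ≈ ∑-tuples as n (λ t → x * f t)
  *-∑-tuples as zero    x f = refl
  *-∑-tuples as (suc n) x f = trans (*-∑-list as x _) (∑-list-cong as λ a → *-∑-tuples as n x _)

  ∑-tuples-* : ∀ (as : List A) n f x → ∑-tuples as n f * x ≈ ∑-tuples as n (λ t → f t * x)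
  ∑-tuples-* as n f x = trans (*-comm _ x)
    (trans (*-∑-tuples as n x f) (∑-tuples-cong as n λ t → *-comm x (f t)))

  ∑-list-comm : ∀ (as : List A) (bs : List B) n (f : A → Vec B n → Carrier) →
    ∑-list as (λ a → ∑-tuples bs n (f a)) ≈ ∑-tuples bs n (λ t → ∑-list as (λ a → f a t))
  ∑-list-comm []       bs n f = sym (∑-tuples-0 bs n)
  ∑-list-comm (a ∷ as) bs n f = trans (+-congˡ (∑-list-comm as bs n f)) (sym (∑-tuples-+ bs n _ _))

  ∑-tuples-comm : ∀ (as : List A) (bs : List B) m n (f : Vec A m → Vec B n → Carrier) →
    ∑-tuples as m (λ s → ∑-tuples bs n (f s)) ≈ ∑-tuples bs n (λ t → ∑-tuples as m (λ s → f s t))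
  ∑-tuples-comm as bs zero    n f = refl
  ∑-tuples-comm as bs (suc m) n f = trans
    (∑-list-cong as λ a → ∑-tuples-comm as bs m n λ s → f (a ∷ s)) (∑-list-comm as bs n _)

  -- Distributivity: expanding a product of sums amounts to choosing one summand per factor. Used
  -- with vertices as factors and states as choices, and with edges as factors and absent or present
  -- as choices.
  product-∑-list : ∀ (as : List A) {n} (f : Fin n → A → Carrier) →
    product (λ i → ∑-list as (f i)) ≈ ∑-tuples as n (λ t → product (λ i → f i (lookup t i)))
  product-∑-list as {zero}  f = refl
  product-∑-list as {suc n} f = begin
    ∑-list as (f zero) * product (λ i → ∑-list as (f (suc i)))
      ≈⟨ trans (*-comm _ _) (*-∑-list as _ _) ⟩
    ∑-list as (λ a → product (λ i → ∑-list as (f (suc i))) * f zero a)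
      ≈⟨ ∑-list-cong as (λ a → trans (*-comm _ _)
           (trans (*-congˡ (product-∑-list as λ i → f (suc i))) (*-∑-tuples as n _ _))) ⟩
    ∑-tuples as (suc n) (λ t → product (λ i → f i (lookup t i))) ∎

  at : Bool → Carrier → Carrier
  at b x = if b then x else 1#

  product-at : ∀ {n} (u : Fin n) x → product (λ v → at (does (v Fin.≟ u)) (x v)) ≈ x u
  product-at {suc n} zero    x = trans (*-congˡ (product-1 n)) (*-identityʳ (x zero))
  product-at {suc n} (suc u) x = trans (*-identityˡ _) (product-at u λ v → x (suc v))

  -- The condition is the incidence test of an edge `uw`; its alternatives exclude each other
  -- because there are no loops, so the factor splits in two.
  product-at₂ : ∀ {n} {u w : Fin n} x → u ≢ w →
    product (λ v → at (does (v Fin.≟ u) ∨ does (v Fin.≟ w)) (x v)) ≈ x u * x w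
  product-at₂ {n} {u} {w} x u≢w = begin
    product (λ v → at (does (v Fin.≟ u) ∨ does (v Fin.≟ w)) (x v))
      ≈⟨ product-cong split ⟩
    product (λ v → at (does (v Fin.≟ u)) (x v) * at (does (v Fin.≟ w)) (x v))
      ≈⟨ product-* (λ v → at (does (v Fin.≟ u)) (x v)) (λ v → at (does (v Fin.≟ w)) (x v)) ⟩
    product (λ v → at (does (v Fin.≟ u)) (x v)) * product (λ v → at (does (v Fin.≟ w)) (x v))
      ≈⟨ *-cong (product-at u x) (product-at w x) ⟩
    x u * x w ∎
    where
    split : ∀ v → at (does (v Fin.≟ u) ∨ does (v Fin.≟ w)) (x v) ≈
                  at (does (v Fin.≟ u)) (x v) * at (does (v Fin.≟ w)) (x v)
    split v with v Fin.≟ u | v Fin.≟ w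
    ... | yes v≡u | yes v≡w = contradiction (≡.trans (≡.sym v≡u) v≡w) u≢w
    ... | yes _   | no  _   = sym (*-identityʳ (x v))
    ... | no  _   | yes _   = sym (*-identityˡ (x v))
    ... | no  _   | no  _   = sym (*-identityˡ 1#)

  pick : Bool → Carrier → Carrier → Carrier
  pick s b a = if s then b else a

  pick-* : ∀ s a b a′ b′ → pick s b a * pick s b′ a′ ≈ pick s (b * b′) (a * a′)
  pick-* true  a b a′ b′ = refl
  pick-* false a b a′ b′ = refl

  -- With `q` the edges at a vertex and `p` the chosen edges, the powers in a vertex weight are
  -- distributed over single edges: each edge at the vertex contributes `b` if chosen and `a` if
  -- not.
  ^-as-product : ∀ {n} (p q : Subset n) a b →
    a ^ (∣ q ∣ ∸ ∣ p ∩ q ∣) * b ^ ∣ p ∩ q ∣ ≈ product (λ e → at (lookup q e) (pick (lookup p e) b a))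
  ^-as-product []            []            a b = *-identityˡ 1#
  ^-as-product (true  ∷ p) (false ∷ q) a b = trans (^-as-product p q a b) (sym (*-identityˡ _))
  ^-as-product (false ∷ p) (false ∷ q) a b = trans (^-as-product p q a b) (sym (*-identityˡ _))
  ^-as-product (true  ∷ p) (true  ∷ q) a b = trans (x*yz≈y*xz _ b _) (*-congˡ (^-as-product p q a b))
  ^-as-product (false ∷ p) (true  ∷ q) a b = begin
    a ^ (suc ∣ q ∣ ∸ ∣ p ∩ q ∣) * b ^ ∣ p ∩ q ∣
      ≈⟨ *-congʳ (reflexive (≡.cong (a ^_) (ℕ.+-∸-assoc 1 (∣p∩q∣≤∣q∣ p q)))) ⟩
    a * a ^ (∣ q ∣ ∸ ∣ p ∩ q ∣) * b ^ ∣ p ∩ q ∣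
      ≈⟨ trans (*-assoc a _ _) (*-congˡ (^-as-product p q a b)) ⟩
    a * product (λ e → at (lookup q e) (pick (lookup p e) b a)) ∎

  z^2∣p∣ : ∀ {n} (p : Subset n) z → z ^ (2 ℕ.* ∣ p ∣) ≈ product (λ e → pick (lookup p e) (z ^ 2) 1#)
  z^2∣p∣ p z = trans (sym (Exp.^-assocʳ semiring z 2 ∣ p ∣)) (power p)
    where
    power : ∀ {n} (p : Subset n) → (z ^ 2) ^ ∣ p ∣ ≈ product (λ e → pick (lookup p e) (z ^ 2) 1#)
    power []          = refl
    power (true  ∷ p) = *-congˡ (power p)
    power (false ∷ p) = trans (power p) (sym (*-identityˡ _))

  -- The subgraph counting polynomial as a partition function

  module _ {d r} (G : Graph) (reg : Regular d G) (x : Vector Carrier (suc d))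
           (κ a b : Fin r → Carrier)
           (x≈ : ∀ k → x k ≈ ∑-list (allFin r) λ i → κ i * (a i ^ (d ∸ toℕ k) * b i ^ toℕ k))
           where

    open Graph G

    private
      end₁ end₂ : Fin size → Fin order
      end₁ e = proj₁ (edge e)
      end₂ e = proj₂ (edge e)

    end₁≢end₂ : ∀ e → end₁ e ≢ end₂ e
    end₁≢end₂ e = Fin.<⇒≢ (increasing e)

    -- Once the powers are products over incident edges, the double product over vertices and edges
    -- can be exchanged, and each edge collects one factor from each of its two ends.
    vertexProduct : ∀ S (σ : Vec (Fin r) order) →
      product (λ v → κ (lookup σ v) * (a (lookup σ v) ^ (d ∸ degreeIn S v) * b (lookup σ v) ^ degreeIn S v)) ≈
      product (λ v → κ (lookup σ v)) *
      product (λ e → pick (lookup S e) (b (lookup σ (end₁ e)) * b (lookup σ (end₂ e)))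
                                       (a (lookup σ (end₁ e)) * a (lookup σ (end₂ e))))
    vertexProduct S σ = trans (product-* (λ v → κ (lookup σ v)) _) (*-congˡ (begin
      product (λ v → aσ v ^ (d ∸ degreeIn S v) * bσ v ^ degreeIn S v)
        -- Regularity enters here: `d` becomes the number of edges at `v`, so that the two exponents
        -- together count exactly those edges.
        ≈⟨ product-cong (λ v → trans
             (reflexive (≡.cong (λ m → aσ v ^ (m ∸ degreeIn S v) * bσ v ^ degreeIn S v) (≡.sym (reg v))))
             (^-as-product S (incident v) (aσ v) (bσ v))) ⟩
      product (λ v → product (λ e → at (lookup (incident v) e) (pick (lookup S e) (bσ v) (aσ v))))
        ≈⟨ product-comm (λ v e → at (lookup (incident v) e) (pick (lookup S e) (bσ v) (aσ v))) ⟩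
      product (λ e → product (λ v → at (lookup (incident v) e) (pick (lookup S e) (bσ v) (aσ v))))
        ≈⟨ product-cong (λ e → trans
             (product-cong (λ v → reflexive (≡.cong (λ s → at s (pick (lookup S e) (bσ v) (aσ v)))
               (lookup∘tabulate _ e))))
             (trans (product-at₂ (λ v → pick (lookup S e) (bσ v) (aσ v)) (end₁≢end₂ e))
               (pick-* (lookup S e) _ _ _ _))) ⟩
      product (λ e → pick (lookup S e) (bσ (end₁ e) * bσ (end₂ e)) (aσ (end₁ e) * aσ (end₂ e))) ∎))
      where
      aσ bσ : Fin order → Carrier
      aσ v = a (lookup σ v)
      bσ v = b (lookup σ v)

    vertexWeights≈ : ∀ S → vertexWeights G reg x S ≈
      ∑-tuples (allFin r) order λ σ → product (λ v → κ (lookup σ v)) *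
      product (λ e → pick (lookup S e) (b (lookup σ (end₁ e)) * b (lookup σ (end₂ e)))
                                       (a (lookup σ (end₁ e)) * a (lookup σ (end₂ e))))
    vertexWeights≈ S = begin
      product (λ v → x (fromℕ< (ℕ.s≤s (degreeIn≤d G reg S v))))
        ≈⟨ product-cong (λ v → trans (x≈ _) (reflexive (≡.cong
             (λ k → ∑-list (allFin r) λ i → κ i * (a i ^ (d ∸ k) * b i ^ k))
             (Fin.toℕ-fromℕ< (ℕ.s≤s (degreeIn≤d G reg S v)))))) ⟩
      product (λ v → ∑-list (allFin r) λ i → κ i * (a i ^ (d ∸ degreeIn S v) * b i ^ degreeIn S v))
        ≈⟨ product-∑-list (allFin r) (λ v i → κ i * (a i ^ (d ∸ degreeIn S v) * b i ^ degreeIn S v)) ⟩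
      ∑-tuples (allFin r) order (λ σ → product (λ v →
        κ (lookup σ v) * (a (lookup σ v) ^ (d ∸ degreeIn S v) * b (lookup σ v) ^ degreeIn S v)))
        ≈⟨ ∑-tuples-cong (allFin r) order (vertexProduct S) ⟩
      _ ∎

    -- After the sums over edge subsets and over states are exchanged, the sum over subsets factors
    -- for fixed states: every edge is independently absent or present, the second with an extra
    -- `z ^ 2`.
    F[z]≈Z : ∀ z → F[z] G reg x z ≈ Z G (λ i j → a i * a j + z ^ 2 * (b i * b j)) κ
    F[z]≈Z z = begin
      ∑-edgeSubsets G (λ S → vertexWeights G reg x S * z ^ (2 ℕ.* ∣ S ∣))
        ≈⟨ ∑-tuples-cong sides size (λ S → trans
             (*-cong (vertexWeights≈ S) (z^2∣p∣ S z))
             (trans (∑-tuples-* (allFin r) order _ _)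
               (∑-tuples-cong (allFin r) order λ σ → absorb S σ))) ⟩
      ∑-tuples sides size (λ S → ∑-tuples (allFin r) order λ σ →
        product (λ v → κ (lookup σ v)) * product (λ e → w σ e (lookup S e)))
        ≈⟨ ∑-tuples-comm sides (allFin r) size order _ ⟩
      ∑-tuples (allFin r) order (λ σ → ∑-tuples sides size λ S →
        product (λ v → κ (lookup σ v)) * product (λ e → w σ e (lookup S e)))
        ≈⟨ ∑-tuples-cong (allFin r) order (λ σ → trans (sym (*-∑-tuples sides size (product (λ v → κ (lookup σ v))) _))
             (*-congˡ (trans (sym (product-∑-list sides (w σ)))
               (product-cong λ e → +-congˡ (+-identityʳ (w σ e inside)))))) ⟩
      Z G (λ i j → a i * a j + z ^ 2 * (b i * b j)) κ ∎
      where
      sides : List Bool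
      sides = outside ∷ inside ∷ []
      w : Vec (Fin r) order → Fin size → Bool → Carrier
      w σ e s = pick s (z ^ 2 * (b (lookup σ (end₁ e)) * b (lookup σ (end₂ e))))
                       (a (lookup σ (end₁ e)) * a (lookup σ (end₂ e)))
      weigh : ∀ s α β → pick s β α * pick s (z ^ 2) 1# ≈ pick s (z ^ 2 * β) α
      weigh true  α β = *-comm β (z ^ 2)
      weigh false α β = *-identityʳ α
      absorb : ∀ S σ →
        (product (λ v → κ (lookup σ v)) *
         product (λ e → pick (lookup S e) (b (lookup σ (end₁ e)) * b (lookup σ (end₂ e)))
                                          (a (lookup σ (end₁ e)) * a (lookup σ (end₂ e))))) *
        product (λ e → pick (lookup S e) (z ^ 2) 1#) ≈
        product (λ v → κ (lookup σ v)) * product (λ e → w σ e (lookup S e))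
      absorb S σ = trans (*-assoc _ _ _) (*-congˡ (trans (sym (product-* (λ e → pick (lookup S e) _ _) _))
        (product-cong λ e → weigh (lookup S e) (a (lookup σ (end₁ e)) * a (lookup σ (end₂ e)))
                                               (b (lookup σ (end₁ e)) * b (lookup σ (end₂ e))))))

    F≈F[1] : F G reg x ≈ F[z] G reg x 1#
    F≈F[1] = ∑-tuples-cong (outside ∷ inside ∷ []) size λ S →
      sym (trans (*-congˡ (1^n≈1 (2 ℕ.* ∣ S ∣))) (*-identityʳ _))
      where
      1^n≈1 : ∀ n → 1# ^ n ≈ 1#
      1^n≈1 zero    = refl
      1^n≈1 (suc n) = trans (*-identityˡ _) (1^n≈1 n)

  Z-cong : ∀ {r} G {N N′ : Fin r → Fin r → Carrier} (κ : Fin r → Carrier) →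
    (∀ i j → N i j ≈ N′ i j) → Z G N κ ≈ Z G N′ κ
  Z-cong {r} G κ N≈N′ = ∑-tuples-cong (allFin r) (Graph.order G) λ σ →
    *-congˡ (product-cong λ e → N≈N′ (lookup σ (proj₁ (Graph.edge G e))) (lookup σ (proj₂ (Graph.edge G e))))

  -- Cutting an edge into two half-edges

  attach : ∀ {r n} → Fin n → (Fin r → Carrier) → (Fin n → Fin r → Carrier) → Fin n → Fin r → Carrier
  attach u h g v k = g v k * at (does (v Fin.≟ u)) (h k)

  product-attach : ∀ {r n} u h (g : Fin n → Fin r → Carrier) (σ : Vec (Fin r) n) →
    product (λ v → attach u h g v (lookup σ v)) ≈ product (λ v → g v (lookup σ v)) * h (lookup σ u)
  product-attach u h g σ = trans (product-* (λ v → g v (lookup σ v)) _)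
    (*-congˡ (product-at u λ v → h (lookup σ v)))

  module Partition {r} (α β : Fin r → Carrier) where

    pendant : Carrier → Carrier → Fin r → Carrier
    pendant x ξ k = α k * ξ + β k * x

    interaction : Carrier → Carrier → Fin r → Fin r → Carrier
    interaction w ω k l = ω * (α k * α l) + w * (β k * β l)

    -- Any list of edges is allowed, with loops and repetitions, and each vertex has its own
    -- weights: the induction removes edges one by one and stores the half-edges in `g`.
    partition : ∀ {n} m (ends : Fin m → Fin n × Fin n) (g : Fin n → Fin r → Carrier) → Carrier → Carrier → Carrier
    partition {n} m ends g w ω = ∑-tuples (allFin r) n λ σ → product (λ v → g v (lookup σ v)) *
      product (λ e → interaction w ω (lookup σ (proj₁ (ends e))) (lookup σ (proj₂ (ends e))))

    partition-without-edges : ∀ {n} ends g w ω → partition {n} 0 ends g w ω ≈ product (λ v → ∑-list (allFin r) (g v))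
    partition-without-edges {n} ends g w ω = trans
      (∑-tuples-cong (allFin r) n λ σ → *-identityʳ _) (sym (product-∑-list (allFin r) g))

    module _ {n m} (ends : Fin (suc m) → Fin n × Fin n) (g : Fin n → Fin r → Carrier) (w ω : Carrier) where

      private
        u v : Fin n
        u = proj₁ (ends zero)
        v = proj₂ (ends zero)
        rest : Fin m → Fin n × Fin n
        rest e = ends (suc e)
        G P : Vec (Fin r) n → Carrier
        G σ = product (λ v → g v (lookup σ v))
        P σ = product (λ e → interaction w ω (lookup σ (proj₁ (rest e))) (lookup σ (proj₂ (rest e))))
        -- The first edge enters only through the matrix `c`, and the sum is linear in `c`. Hence
        -- glueing and cutting this edge are expansions in the same four numbers `cutEdge`.
        T : (Fin r → Fin r → Carrier) → Carrier
        T c = ∑-tuples (allFin r) n λ σ → c (lookup σ u) (lookup σ v) * (G σ * P σ)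
        T-+ : ∀ c d → T (λ k l → c k l + d k l) ≈ T c + T d
        T-+ c d = trans
          (∑-tuples-cong (allFin r) n λ σ →
            distribʳ (G σ * P σ) (c (lookup σ u) (lookup σ v)) (d (lookup σ u) (lookup σ v)))
          (∑-tuples-+ (allFin r) n _ _)
        T-* : ∀ x c → T (λ k l → x * c k l) ≈ x * T c
        T-* x c = trans
          (∑-tuples-cong (allFin r) n λ σ → *-assoc x (c (lookup σ u) (lookup σ v)) (G σ * P σ))
          (sym (*-∑-tuples (allFin r) n x _))
        *-T : ∀ x c → T (λ k l → c k l * x) ≈ T c * x
        *-T x c = trans (∑-tuples-cong (allFin r) n λ σ → *-congʳ (*-comm _ x)) (trans (T-* x c) (*-comm x (T c)))

      cutEdge : (Fin r → Carrier) → (Fin r → Carrier) → Carrier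
      cutEdge a b = T λ k l → a k * b l

      -- Compared with `partition-cut`, glueing keeps only the two outer coefficients of the
      -- bilinear form, those of `ξ * η` and `x * y`.
      partition-contract : partition (suc m) ends g w ω ≈ ω * cutEdge α α + w * cutEdge β β
      partition-contract = trans
        (∑-tuples-cong (allFin r) n λ σ → x*yz≈y*xz (G σ) (interaction w ω (lookup σ u) (lookup σ v)) (P σ))
        (trans (T-+ (λ k l → ω * (α k * α l)) (λ k l → w * (β k * β l)))
          (+-cong (T-* ω λ k l → α k * α l) (T-* w λ k l → β k * β l)))

      partition-cut : ∀ x ξ y η → partition m rest (attach v (pendant y η) (attach u (pendant x ξ) g)) w ω ≈
        cutEdge α α * (ξ * η) + cutEdge β α * (x * η) + cutEdge α β * (ξ * y) + cutEdge β β * (x * y)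
      partition-cut x ξ y η = trans
        (∑-tuples-cong (allFin r) n λ σ → trans
          (*-congʳ (trans (product-attach v (pendant y η) (attach u (pendant x ξ) g) σ)
            (trans (*-congʳ (product-attach u (pendant x ξ) g σ)) (*-assoc (G σ) _ _))))
          (trans (*-congʳ (*-comm (G σ) _))
            (trans (*-assoc _ (G σ) (P σ)) (*-congʳ (expand (lookup σ u) (lookup σ v))))))
        (trans (T-+ (λ k l → term₁ k l + term₂ k l + term₃ k l) term₄)
          (+-cong (trans (T-+ (λ k l → term₁ k l + term₂ k l) term₃)
            (+-cong (trans (T-+ term₁ term₂)
              (+-cong (*-T (ξ * η) λ k l → α k * α l) (*-T (x * η) λ k l → β k * α l)))
              (*-T (ξ * y) λ k l → α k * β l)))
            (*-T (x * y) λ k l → β k * β l)))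
        where
        term₁ term₂ term₃ term₄ : Fin r → Fin r → Carrier
        term₁ k l = α k * α l * (ξ * η)
        term₂ k l = β k * α l * (x * η)
        term₃ k l = α k * β l * (ξ * y)
        term₄ k l = β k * β l * (x * y)
        expand : ∀ k l → pendant x ξ k * pendant y η l ≈ term₁ k l + term₂ k l + term₃ k l + term₄ k l
        expand k l = trans (distribˡ (pendant x ξ k) (α l * η) (β l * y))
          (trans (+-cong (trans (distribʳ (α l * η) _ _) (+-cong (*-interchange _ _ _ _) (*-interchange _ _ _ _)))
                         (trans (distribʳ (β l * y) _ _) (+-cong (*-interchange _ _ _ _) (*-interchange _ _ _ _))))
            (sym (+-assoc _ _ _)))

open import Defs
open ℝ
open _≈_
open ℂ
open _≈ᶜ_

module ℚ-Solver = +-*-Solver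

-- The commutative ring ℝ

half : ∀ {ε} → 0ℚ ℚ.< ε → 0ℚ ℚ.< ε ℚ.* ½
half 0<ε = *-pos 0<ε 0<½

half+half : ∀ ε → ε ℚ.* ½ ℚ.+ ε ℚ.* ½ ≡ ε
half+half = ℚ-Solver.solve 1 (λ e → e :* con ½ :+ e :* con ½ := e) ≡.refl
  where open ℚ-Solver

termwise : ∀ {x y} → (∀ n → seq x n ≡ seq y n) → x ≈ y
termwise {x} {y} eq = mk≈ λ ε 0<ε → 0 , λ n _ →
  subst (λ a → ℚ.∣ a ∣ ℚ.< ε)
    (≡.sym (≡.trans (cong (ℚ._- seq y n) (eq n)) (ℚ.+-inverseʳ (seq y n)))) 0<ε

≈-refl : ∀ {x} → x ≈ x
≈-refl = termwise λ _ → ≡.refl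

≈-sym : ∀ {x y} → x ≈ y → y ≈ x
≈-sym {x} {y} x≈y = mk≈ λ ε 0<ε → let N , h = close x≈y ε 0<ε in N , λ n N≤n →
  subst (ℚ._< ε) (≡.trans (≡.sym (ℚ.∣-p∣≡∣p∣ (seq x n ℚ.- seq y n))) (cong ℚ.∣_∣ (swap (seq x n) (seq y n)))) (h n N≤n)
  where
  open ℚ-Solver
  swap : ∀ a b → ℚ.- (a ℚ.- b) ≡ b ℚ.- a
  swap = solve 2 (λ a b → :- (a :- b) := b :- a) ≡.refl

∣∣-split : ∀ {ε a b c} → c ≡ a ℚ.+ b → ℚ.∣ a ∣ ℚ.< ε ℚ.* ½ → ℚ.∣ b ∣ ℚ.< ε ℚ.* ½ → ℚ.∣ c ∣ ℚ.< ε
∣∣-split {ε} {a} {b} ≡.refl a< b< = ℚ.≤-<-trans (ℚ.∣p+q∣≤∣p∣+∣q∣ a b)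
  (subst (ℚ.∣ a ∣ ℚ.+ ℚ.∣ b ∣ ℚ.<_) (half+half ε) (ℚ.+-mono-< a< b<))

≈-trans : ∀ {x y z} → x ≈ y → y ≈ z → x ≈ z
≈-trans {x} {y} {z} x≈y y≈z = mk≈ λ ε 0<ε →
  let M , h = close x≈y (ε ℚ.* ½) (half 0<ε)
      N , k = close y≈z (ε ℚ.* ½) (half 0<ε)
  in M ℕ.⊔ N , λ n le → ∣∣-split (lemma (seq x n) (seq y n) (seq z n))
       (h n (proj₁ (⊔-max le))) (k n (proj₂ (⊔-max {M} le)))
  where
  open ℚ-Solver
  lemma : ∀ a b c → a ℚ.- c ≡ (a ℚ.- b) ℚ.+ (b ℚ.- c)
  lemma = solve 3 (λ a b c → a :- c := (a :- b) :+ (b :- c)) ≡.refl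

+-cong : ∀ {x y u v} → x ≈ y → u ≈ v → x + u ≈ y + v
+-cong {x} {y} {u} {v} x≈y u≈v = mk≈ λ ε 0<ε →
  let M , h = close x≈y (ε ℚ.* ½) (half 0<ε)
      N , k = close u≈v (ε ℚ.* ½) (half 0<ε)
  in M ℕ.⊔ N , λ n le → ∣∣-split (lemma (seq x n) (seq y n) (seq u n) (seq v n))
       (h n (proj₁ (⊔-max le))) (k n (proj₂ (⊔-max {M} le)))
  where
  open ℚ-Solver
  lemma : ∀ a b c d → (a ℚ.+ c) ℚ.- (b ℚ.+ d) ≡ (a ℚ.- b) ℚ.+ (c ℚ.- d)
  lemma = solve 4 (λ a b c d → (a :+ c) :- (b :+ d) := (a :- b) :+ (c :- d)) ≡.refl

-‿cong : ∀ {x y} → x ≈ y → - x ≈ - y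
-‿cong {x} {y} x≈y = mk≈ λ ε 0<ε → let N , h = close x≈y ε 0<ε in N , λ n N≤n →
  subst (ℚ._< ε) (≡.trans (≡.sym (ℚ.∣-p∣≡∣p∣ (seq x n ℚ.- seq y n))) (cong ℚ.∣_∣ (lemma (seq x n) (seq y n)))) (h n N≤n)
  where
  open ℚ-Solver
  lemma : ∀ a b → ℚ.- (a ℚ.- b) ≡ ℚ.- a ℚ.- ℚ.- b
  lemma = solve 2 (λ a b → :- (a :- b) := :- a :- (:- b)) ≡.refl

*-cong : ∀ {x y u v} → x ≈ y → u ≈ v → x * u ≈ y * v
*-cong {x} {y} {u} {v} x≈y u≈v = mk≈ λ ε 0<ε →
  let A , N₁ , 0<A , hA = eventualBound (isCauchy x)
      B , N₂ , 0<B , hB = eventualBound (isCauchy v)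
      δ , 0<δ , scale   = recipScale (A ℚ.+ B) (ℚ.+-mono-< 0<A 0<B) ε 0<ε
      N₃ , h            = close x≈y δ 0<δ
      N₄ , k            = close u≈v δ 0<δ
  in (N₁ ℕ.⊔ N₂) ℕ.⊔ (N₃ ℕ.⊔ N₄) , λ n le →
  let le₁₂ , le₃₄ = ⊔-max {N₁ ℕ.⊔ N₂} le
      le₁ , le₂   = ⊔-max {N₁} le₁₂
      le₃ , le₄   = ⊔-max {N₃} le₃₄
  in subst (ℚ.∣ seq x n ℚ.* seq u n ℚ.- seq y n ℚ.* seq v n ∣ ℚ.<_) scale
       (products-close A B δ (seq x n) (seq u n) (seq y n) (seq v n) 0<A 0<B
         (hA n le₁) (hB n le₂) (k n le₄) (h n le₃))

ℝ-commutativeRing : CommutativeRing 0ℓ 0ℓ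
ℝ-commutativeRing = record
  { Carrier = ℝ ; _≈_ = _≈_ ; _+_ = _+_ ; _*_ = _*_ ; -_ = -_ ; 0# = 0ℝ ; 1# = 1ℝ
  ; isCommutativeRing = record
    { isRing = record
      { +-isAbelianGroup = record
        { isGroup = record
          { isMonoid = record
            { isSemigroup = record
              { isMagma = record
                { isEquivalence = record { refl = ≈-refl ; sym = ≈-sym ; trans = ≈-trans }
                ; ∙-cong = +-cong }
              ; assoc = λ x y z → termwise λ n → ℚ.+-assoc (seq x n) (seq y n) (seq z n) }
            ; identity = (λ x → termwise λ n → ℚ.+-identityˡ (seq x n))
                       , (λ x → termwise λ n → ℚ.+-identityʳ (seq x n)) }
          ; inverse = (λ x → termwise λ n → ℚ.+-inverseˡ (seq x n))
                    , (λ x → termwise λ n → ℚ.+-inverseʳ (seq x n))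
          ; ⁻¹-cong = -‿cong }
        ; comm = λ x y → termwise λ n → ℚ.+-comm (seq x n) (seq y n) }
      ; *-cong = *-cong
      ; *-assoc = λ x y z → termwise λ n → ℚ.*-assoc (seq x n) (seq y n) (seq z n)
      ; *-identity = (λ x → termwise λ n → ℚ.*-identityˡ (seq x n))
                   , (λ x → termwise λ n → ℚ.*-identityʳ (seq x n))
      ; distrib = (λ x y z → termwise λ n → ℚ.*-distribˡ-+ (seq x n) (seq y n) (seq z n))
                , (λ x y z → termwise λ n → ℚ.*-distribʳ-+ (seq x n) (seq y n) (seq z n)) }
    ; *-comm = λ x y → termwise λ n → ℚ.*-comm (seq x n) (seq y n) } }

fromℚ-homomorphism : CommutativeRing.rawRing ℚ.+-*-commutativeRing
                     -Raw-AlmostCommutative⟶ fromCommutativeRing ℝ-commutativeRing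
fromℚ-homomorphism = record
  { ⟦_⟧ = fromℚ
  ; +-homo = λ _ _ → termwise λ _ → ≡.refl
  ; *-homo = λ _ _ → termwise λ _ → ≡.refl
  ; -‿homo = λ _ → termwise λ _ → ≡.refl
  ; 0-homo = ≈-refl
  ; 1-homo = ≈-refl }

-- Equality of reals is not decidable, but the ring solver has to compare only coefficients, and
-- these are taken from ℚ.
fromℚ-weaklyDecidable : ∀ p q → Maybe (fromℚ p ≈ fromℚ q)
fromℚ-weaklyDecidable p q with p ℚ.≟ q
... | yes ≡.refl = just ≈-refl
... | no  _      = nothing

module ℝ-Solver = RingSolver (CommutativeRing.rawRing ℚ.+-*-commutativeRing)
  (fromCommutativeRing ℝ-commutativeRing) fromℚ-homomorphism fromℚ-weaklyDecidable

-- The order on ℝ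

0<-intro : ∀ x c N → 0ℚ ℚ.< c → (∀ n → N ℕ.≤ n → c ℚ.≤ seq x n) → 0ℝ < x
0<-intro x c N 0<c h = mk< c 0<c N λ n N≤n → subst (ℚ._≤ seq x n) (≡.sym (ℚ.+-identityˡ c)) (h n N≤n)

0<-elim : ∀ {x} → 0ℝ < x → ∃ λ c → 0ℚ ℚ.< c × ∃ λ N → ∀ n → N ℕ.≤ n → c ℚ.≤ seq x n
0<-elim {x} (mk< c 0<c N h) = c , 0<c , N , λ n N≤n → subst (ℚ._≤ seq x n) (ℚ.+-identityˡ c) (h n N≤n)

<⇒0<- : ∀ {x y} → x < y → 0ℝ < y - x
<⇒0<- {x} {y} (mk< c 0<c N h) = 0<-intro (y - x) c N 0<c λ n N≤n →
  subst (ℚ._≤ seq y n ℚ.- seq x n) (lemma (seq x n) c) (ℚ.+-monoˡ-≤ (ℚ.- seq x n) (h n N≤n))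
  where
  open ℚ-Solver
  lemma : ∀ a b → (a ℚ.+ b) ℚ.- a ≡ b
  lemma = solve 2 (λ a b → (a :+ b) :- a := b) ≡.refl

0<-⇒< : ∀ {x y} → 0ℝ < y - x → x < y
0<-⇒< {x} {y} p = let c , 0<c , N , h = 0<-elim p in mk< c 0<c N λ n N≤n →
  subst (seq x n ℚ.+ c ℚ.≤_) (lemma (seq x n) (seq y n)) (ℚ.+-monoʳ-≤ (seq x n) (h n N≤n))
  where
  open ℚ-Solver
  lemma : ∀ a b → a ℚ.+ (b ℚ.- a) ≡ b
  lemma = solve 2 (λ a b → a :+ (b :- a) := b) ≡.refl

p≤∣p∣ : ∀ p → p ℚ.≤ ℚ.∣ p ∣
p≤∣p∣ p with ℚ.≤-total 0ℚ p
... | inj₁ 0≤p = ℚ.≤-reflexive (≡.sym (ℚ.0≤p⇒∣p∣≡p 0≤p))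
... | inj₂ p≤0 = ℚ.≤-trans p≤0 (ℚ.0≤∣p∣ p)

∣a-b∣<ε⇒a<b+ε : ∀ {a b ε} → ℚ.∣ a ℚ.- b ∣ ℚ.< ε → a ℚ.< b ℚ.+ ε
∣a-b∣<ε⇒a<b+ε {a} {b} {ε} h = subst (ℚ._< b ℚ.+ ε) (lemma a b)
  (ℚ.+-monoʳ-< b (ℚ.≤-<-trans (p≤∣p∣ (a ℚ.- b)) h))
  where
  open ℚ-Solver
  lemma : ∀ a b → b ℚ.+ (a ℚ.- b) ≡ a
  lemma = solve 2 (λ a b → b :+ (a :- b) := a) ≡.refl

+-cancelʳ-≤ : ∀ r {p q} → p ℚ.+ r ℚ.≤ q ℚ.+ r → p ℚ.≤ q
+-cancelʳ-≤ r {p} {q} h = ℚ.≮⇒≥ λ q<p → ℚ.<-irrefl ≡.refl (ℚ.<-≤-trans (ℚ.+-monoˡ-< r q<p) h)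

half-≤ : ∀ {c p q} → c ℚ.≤ p → p ℚ.< q ℚ.+ c ℚ.* ½ → c ℚ.* ½ ℚ.≤ q
half-≤ {c} {p} {q} c≤p p< = +-cancelʳ-≤ (c ℚ.* ½)
  (subst (ℚ._≤ q ℚ.+ c ℚ.* ½) (≡.sym (half+half c)) (ℚ.<⇒≤ (ℚ.≤-<-trans c≤p p<)))

0<-resp-≈ : ∀ {x y} → x ≈ y → 0ℝ < x → 0ℝ < y
0<-resp-≈ {x} {y} x≈y p =
  let c , 0<c , M , h = 0<-elim p
      N , k = close x≈y (c ℚ.* ½) (half 0<c)
  in 0<-intro y (c ℚ.* ½) (M ℕ.⊔ N) (half 0<c) λ n le →
     half-≤ (h n (proj₁ (⊔-max {M} le))) (∣a-b∣<ε⇒a<b+ε (k n (proj₂ (⊔-max {M} le))))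

0<x+y : ∀ {x y} → 0ℝ < x → 0ℝ < y → 0ℝ < x + y
0<x+y {x} {y} p q =
  let c , 0<c , M , h = 0<-elim p
      d , 0<d , N , k = 0<-elim q
  in 0<-intro (x + y) (c ℚ.+ d) (M ℕ.⊔ N) (ℚ.+-mono-< 0<c 0<d) λ n le →
     ℚ.+-mono-≤ (h n (proj₁ (⊔-max {M} le))) (k n (proj₂ (⊔-max {M} le)))

*-monoˡ-≤ : ∀ {a b c} → 0ℚ ℚ.≤ c → a ℚ.≤ b → c ℚ.* a ℚ.≤ c ℚ.* b
*-monoˡ-≤ {c = c} 0≤c = ℚ.*-monoˡ-≤-nonNeg c {{ℚ.nonNegative 0≤c}}

*-monoʳ-≤ : ∀ {a b c} → 0ℚ ℚ.≤ c → a ℚ.≤ b → a ℚ.* c ℚ.≤ b ℚ.* c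
*-monoʳ-≤ {c = c} 0≤c = ℚ.*-monoʳ-≤-nonNeg c {{ℚ.nonNegative 0≤c}}

*-mono-≤ : ∀ {a b c d} → 0ℚ ℚ.≤ a → 0ℚ ℚ.≤ d → a ℚ.≤ b → c ℚ.≤ d → a ℚ.* c ℚ.≤ b ℚ.* d
*-mono-≤ 0≤a 0≤d a≤b c≤d = ℚ.≤-trans (*-monoˡ-≤ 0≤a c≤d) (*-monoʳ-≤ 0≤d a≤b)

0<x*y : ∀ {x y} → 0ℝ < x → 0ℝ < y → 0ℝ < x * y
0<x*y {x} {y} p q =
  let c , 0<c , M , h = 0<-elim p
      d , 0<d , N , k = 0<-elim q
  in 0<-intro (x * y) (c ℚ.* d) (M ℕ.⊔ N) (*-pos 0<c 0<d) λ n le →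
     let d≤y = k n (proj₂ (⊔-max {M} le))
     in *-mono-≤ (ℚ.<⇒≤ 0<c) (ℚ.≤-trans (ℚ.<⇒≤ 0<d) d≤y) (h n (proj₁ (⊔-max {M} le))) d≤y

0≮0 : ¬ 0ℝ < 0ℝ
0≮0 p = let c , 0<c , N , h = 0<-elim p in ℚ.<-irrefl ≡.refl (ℚ.<-≤-trans 0<c (h N ℕ.≤-refl))

0<⇒≉0 : ∀ {x} → 0ℝ < x → ¬ x ≈ 0ℝ
0<⇒≉0 p x≈0 = 0≮0 (0<-resp-≈ x≈0 p)

0<1 : 0ℝ < 1ℝ
0<1 = 0<-intro 1ℝ 1ℚ 0 (ℚ.positive⁻¹ 1ℚ) λ _ _ → ℚ.≤-refl

0<2 : 0ℝ < 2ℝ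
0<2 = 0<-intro 2ℝ (1ℚ ℚ.+ 1ℚ) 0 (ℚ.positive⁻¹ (1ℚ ℚ.+ 1ℚ)) λ _ _ → ℚ.≤-refl

-- The constructive substitute for trichotomy. At one late index the rational terms decide which
-- summand is at least half of the gap `c`; a Cauchy modulus of `c / 4` keeps that summand above
-- `c / 4` from then on.
0<x+y⇒0<x∨0<y : ∀ {x y} → 0ℝ < x + y → 0ℝ < x ⊎ 0ℝ < y
0<x+y⇒0<x∨0<y {x} {y} p =
  let c , 0<c , L , h = 0<-elim p
      0<c/4 = half (half 0<c)
      M , cauchy-x = isCauchy x (c ℚ.* ½ ℚ.* ½) 0<c/4
      N , cauchy-y = isCauchy y (c ℚ.* ½ ℚ.* ½) 0<c/4
      m = L ℕ.⊔ (M ℕ.⊔ N)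
      L≤m , M⊔N≤m = ⊔-max {L} ℕ.≤-refl
      M≤m , N≤m = ⊔-max {M} M⊔N≤m
  in decide c 0<c m (h m L≤m)
       (M , λ n M≤n → cauchy-x m n M≤m M≤n) (N , λ n N≤n → cauchy-y m n N≤m N≤n)
  where
  Near : ℝ → ℚ → ℕ → Set
  Near z ε m = ∃ λ N → ∀ n → N ℕ.≤ n → ℚ.∣ seq z m ℚ.- seq z n ∣ ℚ.< ε
  large : ∀ z c m → 0ℚ ℚ.< c → Near z (c ℚ.* ½) m → c ℚ.≤ seq z m → 0ℝ < z
  large z c m 0<c (N , near) c≤z = 0<-intro z (c ℚ.* ½) N (half 0<c) λ n N≤n →
    half-≤ c≤z (∣a-b∣<ε⇒a<b+ε (near n N≤n))
  decide : ∀ c → 0ℚ ℚ.< c → ∀ m → c ℚ.≤ seq x m ℚ.+ seq y m →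
           Near x (c ℚ.* ½ ℚ.* ½) m → Near y (c ℚ.* ½ ℚ.* ½) m → 0ℝ < x ⊎ 0ℝ < y
  decide c 0<c m c≤x+y near-x near-y =
    [ (λ c/2≤x → inj₁ (large x (c ℚ.* ½) m (half 0<c) near-x c/2≤x))
    , (λ x≤c/2 → inj₂ (large y (c ℚ.* ½) m (half 0<c) near-y
        (+-cancelʳ-≤ (c ℚ.* ½) (subst (ℚ._≤ seq y m ℚ.+ c ℚ.* ½) (≡.sym (half+half c))
          (ℚ.≤-trans c≤x+y (subst (seq x m ℚ.+ seq y m ℚ.≤_) (ℚ.+-comm (c ℚ.* ½) (seq y m))
            (ℚ.+-monoˡ-≤ (seq y m) x≤c/2)))))))
    ]′ (ℚ.≤-total (c ℚ.* ½) (seq x m))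

-- If eventually `x ≤ B` and `d ≤ x y`, then `y` stays above `d / B`.
0<x*y⇒0<y : ∀ {x y} → 0ℝ < x → 0ℝ < x * y → 0ℝ < y
0<x*y⇒0<y {x} {y} p q =
  let c , 0<c , M , h = 0<-elim p
      d , 0<d , N , k = 0<-elim q
      B , L , 0<B , bound = eventualBound (isCauchy x)
      e , 0<e , scale = recipScale B 0<B d 0<d
  in 0<-intro y e (M ℕ.⊔ (N ℕ.⊔ L)) 0<e λ n le →
     let M≤n , le′ = ⊔-max {M} le
         N≤n , L≤n = ⊔-max {N} le′
         0<xₙ = ℚ.<-≤-trans 0<c (h n M≤n)
     in ℚ.≮⇒≥ λ y<e → ℚ.<-irrefl ≡.refl (ℚ.≤-<-trans (k n N≤n)
          (ℚ.<-≤-trans (ℚ.*-monoʳ-<-pos (seq x n) {{ℚ.positive 0<xₙ}} y<e)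
            (subst (seq x n ℚ.* e ℚ.≤_) scale
              (*-monoʳ-≤ (ℚ.<⇒≤ 0<e) (ℚ.≤-trans (p≤∣p∣ (seq x n)) (bound n L≤n))))))

tight : ∀ {x} → ¬ 0ℝ < x → ¬ 0ℝ < - x → x ≈ 0ℝ
tight {x} ¬0<x ¬0<-x = mk≈ λ ε 0<ε →
  let M , h = below x ¬0<x ε 0<ε
      N , k = below (- x) ¬0<-x ε 0<ε
  in M ℕ.⊔ N , λ n le → ∣∣< (seq x n) (h n (proj₁ (⊔-max {M} le))) (k n (proj₂ (⊔-max {M} le)))
  where
  below : ∀ z → ¬ 0ℝ < z → ∀ ε → 0ℚ ℚ.< ε → ∃ λ N → ∀ n → N ℕ.≤ n → seq z n ℚ.< ε
  below z ¬0<z ε 0<ε = let N , cauchy = isCauchy z (ε ℚ.* ½) (half 0<ε) in N , λ n N≤n →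
    ℚ.≰⇒> λ ε≤z → ¬0<z (0<-intro z (ε ℚ.* ½) N (half 0<ε) λ k N≤k →
      half-≤ ε≤z (∣a-b∣<ε⇒a<b+ε (cauchy n k N≤n N≤k)))
  ∣∣< : ∀ {ε} p → p ℚ.< ε → ℚ.- p ℚ.< ε → ℚ.∣ p ℚ.- 0ℚ ∣ ℚ.< ε
  ∣∣< {ε} p p< -p< = subst (λ q → ℚ.∣ q ∣ ℚ.< ε) (≡.sym (ℚ.+-identityʳ p)) ([
    (λ e → subst (ℚ._< ε) (≡.sym e) p<) , (λ e → subst (ℚ._< ε) (≡.sym e) -p<) ]′ (ℚ.∣p∣≡p∨∣p∣≡-p p))

0≮-x² : ∀ x → ¬ 0ℝ < - (x * x)
0≮-x² x p = let c , 0<c , N , h = 0<-elim p in ℚ.<-irrefl ≡.refl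
  (ℚ.<-≤-trans 0<c (ℚ.≤-trans (h N ℕ.≤-refl) (ℚ.neg-antimono-≤ (square (seq x N)))))
  where
  square : ∀ p → 0ℚ ℚ.≤ p ℚ.* p
  square p = subst (0ℚ ℚ.≤_) (≡.trans (ℚ.∣p*q∣≡∣p∣*∣q∣ p p) (∣p∣²≡p² p)) (ℚ.0≤∣p∣ (p ℚ.* p))
    where
    open ℚ-Solver
    ∣p∣²≡p² : ∀ p → ℚ.∣ p ∣ ℚ.* ℚ.∣ p ∣ ≡ p ℚ.* p
    ∣p∣²≡p² p with ℚ.∣p∣≡p∨∣p∣≡-p p
    ... | inj₁ e = ≡.cong₂ ℚ._*_ e e
    ... | inj₂ e = ≡.trans (≡.cong₂ ℚ._*_ e e) (solve 1 (λ p → (:- p) :* (:- p) := p :* p) ≡.refl p)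

x*inv≈1 : ∀ x (p : 0ℝ < x) → x * inv x p ≈ 1ℝ
x*inv≈1 x p@(mk< c 0<c N h) = mk≈ λ ε 0<ε → N , λ n N≤n →
  subst (λ a → ℚ.∣ a ∣ ℚ.< ε) (≡.sym (eq n N≤n)) 0<ε
  where
  eq : ∀ n → N ℕ.≤ n → seq x n ℚ.* recipSeq (seq x) c 0<c n ℚ.- 1ℚ ≡ 0ℚ
  eq n N≤n = ≡.trans (cong (ℚ._- 1ℚ) (≡.trans (ℚ.*-comm (seq x n) _)
    (≡.trans (cong (recipSeq (seq x) c 0<c n ℚ.*_) (≡.sym x⊔c≡x))
      (recip-inverse (seq x n ℚ.⊔ c) (ℚ.<-≤-trans 0<c (ℚ.p≤q⊔p (seq x n) c)))))) (ℚ.+-inverseʳ 1ℚ)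
    where
    x⊔c≡x : seq x n ℚ.⊔ c ≡ seq x n
    x⊔c≡x = ℚ.p≥q⇒p⊔q≡p (subst (ℚ._≤ seq x n) (ℚ.+-identityˡ c) (h n N≤n))

0<inv : ∀ x (p : 0ℝ < x) → 0ℝ < inv x p
0<inv x p = 0<x*y⇒0<y p (0<-resp-≈ (≈-sym (x*inv≈1 x p)) 0<1)

x-y≈0⇒x≈y : ∀ {x y} → x - y ≈ 0ℝ → x ≈ y
x-y≈0⇒x≈y {x} {y} h = ≈-trans (solve 2 (λ x y → x := x :- y :+ y) ≈-refl x y)
  (≈-trans (+-cong h (≈-refl {y})) (CommutativeRing.+-identityˡ ℝ-commutativeRing y))
  where open ℝ-Solver

-- Roots of positive real numbers

module ℚ^ = RawSemiringOps (RawRing.rawSemiring (CommutativeRing.rawRing ℚ.+-*-commutativeRing))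

_ℚ^_ : ℚ → ℕ → ℚ
_ℚ^_ = ℚ^._^_

_ℚ×_ : ℕ → ℚ → ℚ
_ℚ×_ = ℚ^._×_

infixr 8 _ℚ^_ _ℚ×_

-- Addition in ℚ reduces fractions, which hides the numerator. Among the unnormalised rationals a
-- sum of `n` ones is visibly `n / 1`.
toℚᵘ-× : ∀ n → ℚ.toℚᵘ (n ℚ× 1ℚ) ℚᵘ.≃ ℚᵘ.mkℚᵘ (+ n) 0
toℚᵘ-× zero    = ℚᵘ.≃-refl
toℚᵘ-× (suc n) = ℚᵘ.≃-trans (ℚ.toℚᵘ-homo-+ 1ℚ (n ℚ× 1ℚ))
  (ℚᵘ.≃-trans (ℚᵘ.+-congʳ ℚᵘ.1ℚᵘ (toℚᵘ-× n)) (ℚᵘ.*≡* (cong (ℤ._* + 1)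
    (≡.cong₂ ℤ._+_ (ℤ.*-identityˡ (+ 1)) (ℤ.*-identityʳ (+ n))))))

archimedean : ∀ q → ∃ λ n → q ℚ.< n ℚ× 1ℚ
archimedean q@(ℚ.mkℚ num den-1 _) = suc ℤ.∣ num ∣ , ℚ.toℚᵘ-cancel-<
  (ℚᵘ.<-respʳ-≃ (ℚᵘ.≃-sym (toℚᵘ-× (suc ℤ.∣ num ∣))) (ℚᵘ.*<* (bound num)))
  where
  bound : ∀ i → i ℤ.* + 1 ℤ.< + suc ℤ.∣ i ∣ ℤ.* + suc den-1
  bound (+ n) = subst (ℤ._< + suc n ℤ.* + suc den-1) (≡.sym (ℤ.*-identityʳ (+ n)))
    (subst (+ n ℤ.<_) (ℤ.pos-* (suc n) (suc den-1)) (ℤ.+<+ (ℕ.m≤m*n (suc n) (suc den-1))))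
  bound ℤ.-[1+ n ] = ℤ.-<+

archimedean-× : ∀ q δ → 0ℚ ℚ.< δ → ∃ λ n → q ℚ.< n ℚ× δ
archimedean-× q δ 0<δ = let n , h = archimedean (q ℚ.* recip δ 0<δ) in n ,
  ≡.subst₂ ℚ._<_ (≡.trans (ℚ.*-assoc q _ δ) (≡.trans (cong (q ℚ.*_) (recip-inverse δ 0<δ)) (ℚ.*-identityʳ q)))
    (≡.trans (Mult.×-assoc-* (CommutativeRing.semiring ℚ.+-*-commutativeRing) n 1ℚ δ) (cong (n ℚ×_) (ℚ.*-identityˡ δ)))
    (ℚ.*-monoˡ-<-pos δ {{ℚ.positive 0<δ}} h)

0<1ℚ : 0ℚ ℚ.< 1ℚ
0<1ℚ = ℚ.positive⁻¹ 1ℚ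

0≤n× : ∀ n {δ} → 0ℚ ℚ.≤ δ → 0ℚ ℚ.≤ n ℚ× δ
0≤n× zero    0≤δ = ℚ.≤-refl
0≤n× (suc n) 0≤δ = ℚ.+-mono-≤ 0≤δ (0≤n× n 0≤δ)

×1-mono-≤ : ∀ {m n} → m ℕ.≤ n → m ℚ× 1ℚ ℚ.≤ n ℚ× 1ℚ
×1-mono-≤ {n = n} ℕ.z≤n = 0≤n× n (ℚ.<⇒≤ 0<1ℚ)
×1-mono-≤ (ℕ.s≤s m≤n) = ℚ.+-monoʳ-≤ 1ℚ (×1-mono-≤ m≤n)

0<1+n : ∀ n → 0ℚ ℚ.< suc n ℚ× 1ℚ
0<1+n n = ℚ.+-mono-<-≤ 0<1ℚ (0≤n× n (ℚ.<⇒≤ 0<1ℚ))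

1/1+ : ℕ → ℚ
1/1+ n = recip (suc n ℚ× 1ℚ) (0<1+n n)

1/1+-small : ∀ ε → 0ℚ ℚ.< ε → ∃ λ N → ∀ n → N ℕ.≤ n → 1/1+ n ℚ.< ε
1/1+-small ε 0<ε = let N , h = archimedean-× 1ℚ ε 0<ε in N , λ n N≤n →
  ℚ.≰⇒> λ ε≤δ → ℚ.<-irrefl ≡.refl (ℚ.<-≤-trans h (ℚ.≤-trans
    (subst (ℚ._≤ (suc n ℚ× 1ℚ) ℚ.* ε) (≡.trans (Mult.×-assoc-* ℚ-semiring N 1ℚ ε) (cong (N ℚ×_) (ℚ.*-identityˡ ε)))
      (*-monoʳ-≤ (ℚ.<⇒≤ 0<ε) (×1-mono-≤ (ℕ.m≤n⇒m≤1+n N≤n))))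
    (subst ((suc n ℚ× 1ℚ) ℚ.* ε ℚ.≤_) (≡.trans (ℚ.*-comm (suc n ℚ× 1ℚ) (1/1+ n)) (recip-inverse (suc n ℚ× 1ℚ) (0<1+n n)))
      (*-monoˡ-≤ (ℚ.<⇒≤ (0<1+n n)) ε≤δ))))
  where ℚ-semiring = CommutativeRing.semiring ℚ.+-*-commutativeRing

0<^ : ∀ {a} n → 0ℚ ℚ.< a → 0ℚ ℚ.< a ℚ^ n
0<^ zero    0<a = 0<1ℚ
0<^ (suc n) 0<a = *-pos 0<a (0<^ n 0<a)

0≤* : ∀ {a b} → 0ℚ ℚ.≤ a → 0ℚ ℚ.≤ b → 0ℚ ℚ.≤ a ℚ.* b
0≤* {a} {b} 0≤a 0≤b = subst (ℚ._≤ a ℚ.* b) (ℚ.*-zeroʳ a) (*-monoˡ-≤ 0≤a 0≤b)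

0≤^ : ∀ {a} n → 0ℚ ℚ.≤ a → 0ℚ ℚ.≤ a ℚ^ n
0≤^ zero    0≤a = ℚ.<⇒≤ 0<1ℚ
0≤^ (suc n) 0≤a = 0≤* 0≤a (0≤^ n 0≤a)

^-mono-≤ : ∀ {a b} n → 0ℚ ℚ.≤ a → a ℚ.≤ b → a ℚ^ n ℚ.≤ b ℚ^ n
^-mono-≤ zero    0≤a a≤b = ℚ.≤-refl
^-mono-≤ (suc n) 0≤a a≤b = *-mono-≤ 0≤a (0≤^ n (ℚ.≤-trans 0≤a a≤b)) a≤b (^-mono-≤ n 0≤a a≤b)

1^n≡1 : ∀ n → 1ℚ ℚ^ n ≡ 1ℚ
1^n≡1 zero    = ≡.refl
1^n≡1 (suc n) = ≡.trans (ℚ.*-identityˡ (1ℚ ℚ^ n)) (1^n≡1 n)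

a≤1⇒a^1+n≤a : ∀ {a} n → 0ℚ ℚ.≤ a → a ℚ.≤ 1ℚ → a ℚ^ suc n ℚ.≤ a
a≤1⇒a^1+n≤a {a} n 0≤a a≤1 = subst (a ℚ^ suc n ℚ.≤_) (ℚ.*-identityʳ a)
  (*-monoˡ-≤ 0≤a (subst (a ℚ^ n ℚ.≤_) (1^n≡1 n) (^-mono-≤ n 0≤a a≤1)))

1≤a⇒a≤a^1+n : ∀ {a} n → 1ℚ ℚ.≤ a → a ℚ.≤ a ℚ^ suc n
1≤a⇒a≤a^1+n {a} n 1≤a = subst (ℚ._≤ a ℚ^ suc n) (ℚ.*-identityʳ a)
  (*-monoˡ-≤ (ℚ.≤-trans (ℚ.<⇒≤ 0<1ℚ) 1≤a)
    (subst (ℚ._≤ a ℚ^ n) (1^n≡1 n) (^-mono-≤ n (ℚ.<⇒≤ 0<1ℚ) 1≤a)))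

-- Multiply the induction hypothesis by `a + b` and use that `a` and `b` are at most `a + b`. It
-- stands in for the uniform continuity of roots.
^-superadditive : ∀ {a b} n → 0ℚ ℚ.≤ a → 0ℚ ℚ.≤ b →
                  a ℚ^ suc n ℚ.+ b ℚ^ suc n ℚ.≤ (a ℚ.+ b) ℚ^ suc n
^-superadditive {a} {b} zero 0≤a 0≤b =
  ℚ.≤-reflexive (≡.sym (ℚ.*-distribʳ-+ 1ℚ a b))
^-superadditive {a} {b} (suc n) 0≤a 0≤b = ℚ.≤-trans
  (ℚ.+-mono-≤ (*-monoʳ-≤ (0≤^ (suc n) 0≤a) a≤a+b) (*-monoʳ-≤ (0≤^ (suc n) 0≤b) b≤a+b))
  (subst (ℚ._≤ (a ℚ.+ b) ℚ^ suc (suc n)) (ℚ.*-distribˡ-+ (a ℚ.+ b) (a ℚ^ suc n) (b ℚ^ suc n))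
    (*-monoˡ-≤ (ℚ.+-mono-≤ 0≤a 0≤b) (^-superadditive n 0≤a 0≤b)))
  where
  a≤a+b : a ℚ.≤ a ℚ.+ b
  a≤a+b = subst (ℚ._≤ a ℚ.+ b) (ℚ.+-identityʳ a) (ℚ.+-monoʳ-≤ a 0≤b)
  b≤a+b : b ℚ.≤ a ℚ.+ b
  b≤a+b = subst (ℚ._≤ a ℚ.+ b) (ℚ.+-identityˡ b) (ℚ.+-monoˡ-≤ b 0≤a)

record RootApproximation (n : ℕ) (q δ : ℚ) : Set where
  field
    y      : ℚ
    0≤y    : 0ℚ ℚ.≤ y
    y^≤q   : y ℚ^ suc n ℚ.≤ q
    q<y+δ^ : q ℚ.< (y ℚ.+ δ) ℚ^ suc n

-- A downward search on the grid of multiples of `δ`, where powers are compared in ℚ and hence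
-- decidably; it stops at a grid point whose power is at most `q` while that of the next one exceeds
-- `q`.
approximateRoot : ∀ n q δ → 0ℚ ℚ.≤ q → 0ℚ ℚ.< δ → RootApproximation n q δ
approximateRoot n q δ 0≤q 0<δ =
  -- With `q + 1` as the bound, the starting point is at least 1, so its power is no smaller than
  -- itself and exceeds `q`.
  let K , h = archimedean-× (q ℚ.+ 1ℚ) δ 0<δ
      q+1≤ = ℚ.<⇒≤ h
      1≤ = ℚ.≤-trans (subst (ℚ._≤ q ℚ.+ 1ℚ) (ℚ.+-identityˡ 1ℚ) (ℚ.+-monoˡ-≤ 1ℚ 0≤q)) q+1≤
  in search K (ℚ.<-≤-trans (ℚ.<-≤-trans q<q+1 q+1≤) (1≤a⇒a≤a^1+n n 1≤))
  where
  q<q+1 : q ℚ.< q ℚ.+ 1ℚ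
  q<q+1 = subst (ℚ._< q ℚ.+ 1ℚ) (ℚ.+-identityʳ q) (ℚ.+-monoʳ-< q 0<1ℚ)
  search : ∀ K → q ℚ.< (K ℚ× δ) ℚ^ suc n → RootApproximation n q δ
  search zero    q<0 = ⊥-elim (ℚ.<-irrefl ≡.refl (ℚ.≤-<-trans 0≤q (subst (q ℚ.<_) (ℚ.*-zeroˡ (0ℚ ℚ^ n)) q<0)))
  search (suc K) q< with (K ℚ× δ) ℚ^ suc n ℚ.≤? q
  ... | yes ≤q = record
    { y = K ℚ× δ ; 0≤y = 0≤n× K (ℚ.<⇒≤ 0<δ) ; y^≤q = ≤q
    ; q<y+δ^ = subst (λ a → q ℚ.< a ℚ^ suc n) (ℚ.+-comm δ (K ℚ× δ)) q< }
  ... | no  ≰q = search K (ℚ.≰⇒> ≰q)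

seq-^ : ∀ x n k → seq (x ^ n) k ≡ seq x k ℚ^ n
seq-^ x zero    k = ≡.refl
seq-^ x (suc n) k = cong (seq x k ℚ.*_) (seq-^ x n k)

p≤q⇒p-q≤0 : ∀ {p q} → p ℚ.≤ q → p ℚ.- q ℚ.≤ 0ℚ
p≤q⇒p-q≤0 {p} {q} p≤q = subst (p ℚ.- q ℚ.≤_) (ℚ.+-inverseʳ q) (ℚ.+-monoˡ-≤ (ℚ.- q) p≤q)

p≤q⇒0≤q-p : ∀ {p q} → p ℚ.≤ q → 0ℚ ℚ.≤ q ℚ.- p
p≤q⇒0≤q-p {p} {q} p≤q = subst (ℚ._≤ q ℚ.- p) (ℚ.+-inverseʳ p) (ℚ.+-monoˡ-≤ (ℚ.- p) p≤q)

module Root (x : ℝ) (0<x : 0ℝ < x) (d : ℕ) where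

  -- Cutting off negative terms at 0 provides an approximation at every index and changes nothing
  -- from `N₀` on.
  approximation : ∀ n → RootApproximation d (seq x n ℚ.⊔ 0ℚ) (1/1+ n)
  approximation n = approximateRoot d (seq x n ℚ.⊔ 0ℚ) (1/1+ n) (ℚ.p≤q⊔p (seq x n) 0ℚ)
    (0<recip (suc n ℚ× 1ℚ) (0<1+n n))

  rootSeq : ℕ → ℚ
  rootSeq n = RootApproximation.y (approximation n)

  0≤rootSeq : ∀ n → 0ℚ ℚ.≤ rootSeq n
  0≤rootSeq n = RootApproximation.0≤y (approximation n)

  gap : ∃ λ c → 0ℚ ℚ.< c × ∃ λ N → ∀ n → N ℕ.≤ n → c ℚ.≤ seq x n
  gap = 0<-elim 0<x

  c = proj₁ gap
  0<c = proj₁ (proj₂ gap)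
  N₀ = proj₁ (proj₂ (proj₂ gap))
  c≤x = proj₂ (proj₂ (proj₂ gap))

  x⊔0≡x : ∀ n → N₀ ℕ.≤ n → seq x n ℚ.⊔ 0ℚ ≡ seq x n
  x⊔0≡x n N₀≤n = ℚ.p≥q⇒p⊔q≡p (ℚ.≤-trans (ℚ.<⇒≤ 0<c) (c≤x n N₀≤n))

  rootSeq^≤x : ∀ n → N₀ ℕ.≤ n → rootSeq n ℚ^ suc d ℚ.≤ seq x n
  rootSeq^≤x n N₀≤n = subst (rootSeq n ℚ^ suc d ℚ.≤_) (x⊔0≡x n N₀≤n) (RootApproximation.y^≤q (approximation n))

  x<rootSeq+δ^ : ∀ n → N₀ ℕ.≤ n → seq x n ℚ.< (rootSeq n ℚ.+ 1/1+ n) ℚ^ suc d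
  x<rootSeq+δ^ n N₀≤n = subst (ℚ._< (rootSeq n ℚ.+ 1/1+ n) ℚ^ suc d) (x⊔0≡x n N₀≤n)
    (RootApproximation.q<y+δ^ (approximation n))

  -- By superadditivity of t ↦ t^(1+d) on t ≥ 0, roots ε apart have powers at least (ε/2)^(1+d) apart.
  rootSeq-close : ∀ ε m n → 0ℚ ℚ.< ε → N₀ ℕ.≤ m → N₀ ℕ.≤ n → 1/1+ m ℚ.< ε ℚ.* ½ →
    ℚ.∣ seq x n ℚ.- seq x m ∣ ℚ.< (ε ℚ.* ½) ℚ^ suc d → rootSeq n ℚ.- rootSeq m ℚ.< ε
  rootSeq-close ε m n 0<ε N₀≤m N₀≤n δ< x< = ℚ.≰⇒> λ ε≤ → ℚ.<-irrefl ≡.refl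
    (ℚ.<-trans (ℚ.<-≤-trans (ℚ.+-monoˡ-< ((ε ℚ.* ½) ℚ^ suc d) (x<rootSeq+δ^ m N₀≤m))
        (ℚ.≤-trans (^-superadditive d 0≤y+δ (ℚ.<⇒≤ (half 0<ε)))
          (ℚ.≤-trans (^-mono-≤ (suc d) (ℚ.+-mono-≤ 0≤y+δ (ℚ.<⇒≤ (half 0<ε))) (≤rootSeq ε≤)) (rootSeq^≤x n N₀≤n))))
      (∣a-b∣<ε⇒a<b+ε x<))
    where
    0≤y+δ : 0ℚ ℚ.≤ rootSeq m ℚ.+ 1/1+ m
    0≤y+δ = ℚ.+-mono-≤ (0≤rootSeq m) (ℚ.<⇒≤ (0<recip (suc m ℚ× 1ℚ) (0<1+n m)))
    open ℚ-Solver
    rearrange : ∀ a b e → a ℚ.+ e ℚ.* ½ ℚ.+ e ℚ.* ½ ℚ.+ (b ℚ.- a) ≡ e ℚ.+ b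
    rearrange = solve 3 (λ a b e → a :+ e :* con ½ :+ e :* con ½ :+ (b :- a) := e :+ b) ≡.refl
    ≤rootSeq : ε ℚ.≤ rootSeq n ℚ.- rootSeq m → rootSeq m ℚ.+ 1/1+ m ℚ.+ ε ℚ.* ½ ℚ.≤ rootSeq n
    ≤rootSeq ε≤ = ℚ.≤-trans
      (ℚ.+-monoˡ-≤ (ε ℚ.* ½) (ℚ.+-monoʳ-≤ (rootSeq m) (ℚ.<⇒≤ δ<)))
      (+-cancelʳ-≤ ε (subst (rootSeq m ℚ.+ ε ℚ.* ½ ℚ.+ ε ℚ.* ½ ℚ.+ ε ℚ.≤_)
        (≡.trans (rearrange (rootSeq m) (rootSeq n) ε) (ℚ.+-comm ε (rootSeq n)))
        (ℚ.+-monoʳ-≤ (rootSeq m ℚ.+ ε ℚ.* ½ ℚ.+ ε ℚ.* ½) ε≤)))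

  rootSeq-cauchy : IsCauchy rootSeq
  rootSeq-cauchy ε 0<ε =
    let M , δ-small  = 1/1+-small (ε ℚ.* ½) (half 0<ε)
        L , x-cauchy = isCauchy x ((ε ℚ.* ½) ℚ^ suc d) (0<^ (suc d) (half 0<ε))
    in N₀ ℕ.⊔ (M ℕ.⊔ L) , λ m n le le′ →
       let N₀≤m , lm = ⊔-max {N₀} le
           N₀≤n , ln = ⊔-max {N₀} le′
           M≤m , L≤m = ⊔-max {M} lm
           M≤n , L≤n = ⊔-max {M} ln
           n-m = rootSeq-close ε m n 0<ε N₀≤m N₀≤n (δ-small m M≤m) (x-cauchy n m L≤n L≤m)
           m-n = rootSeq-close ε n m 0<ε N₀≤n N₀≤m (δ-small n M≤n) (x-cauchy m n L≤m L≤n)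
       in [ (λ e → subst (ℚ._< ε) (≡.sym e) m-n)
          , (λ e → subst (ℚ._< ε) (≡.sym (≡.trans e (negate (rootSeq m) (rootSeq n)))) n-m)
          ]′ (ℚ.∣p∣≡p∨∣p∣≡-p (rootSeq m ℚ.- rootSeq n))
    where
    open ℚ-Solver
    negate : ∀ a b → ℚ.- (a ℚ.- b) ≡ b ℚ.- a
    negate = solve 2 (λ a b → :- (a :- b) := b :- a) ≡.refl

  root : ℝ
  root = mkℝ rootSeq rootSeq-cauchy

  δ-close : ∀ ε → 0ℚ ℚ.< ε → ∃ λ N → ∀ n → N ℕ.≤ n → ℚ.∣ 0ℚ ℚ.- 1/1+ n ∣ ℚ.< ε
  δ-close ε 0<ε = let N , h = 1/1+-small ε 0<ε in N , λ n N≤n →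
    subst (ℚ._< ε) (≡.sym (≡.trans (cong ℚ.∣_∣ (ℚ.+-identityˡ (ℚ.- 1/1+ n)))
      (≡.trans (ℚ.∣-p∣≡∣p∣ (1/1+ n)) (ℚ.0≤p⇒∣p∣≡p (ℚ.<⇒≤ (0<recip (suc n ℚ× 1ℚ) (0<1+n n))))))) (h n N≤n)

  δ-cauchy : IsCauchy 1/1+
  δ-cauchy ε 0<ε = let N , h = δ-close (ε ℚ.* ½) (half 0<ε) in N , λ m n N≤m N≤n →
    ∣∣-split (split (1/1+ m) (1/1+ n)) (subst (ℚ._< ε ℚ.* ½) (negate (1/1+ m)) (h m N≤m)) (h n N≤n)
    where
    open ℚ-Solver
    split : ∀ a b → a ℚ.- b ≡ a ℚ.+ (0ℚ ℚ.- b)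
    split = solve 2 (λ a b → a :- b := a :+ (con 0ℚ :- b)) ≡.refl
    negate : ∀ a → ℚ.∣ 0ℚ ℚ.- a ∣ ≡ ℚ.∣ a ∣
    negate a = ≡.trans (cong ℚ.∣_∣ (ℚ.+-identityˡ (ℚ.- a))) (ℚ.∣-p∣≡∣p∣ a)

  δ : ℝ
  δ = mkℝ 1/1+ δ-cauchy

  root+δ≈root : root + δ ≈ root
  root+δ≈root = ≈-trans (+-cong (≈-refl {root}) (≈-sym (mk≈ {0ℝ} {δ} δ-close)))
    (CommutativeRing.+-identityʳ ℝ-commutativeRing root)

  -- The lower bracket refutes one strict inequality directly. The upper bracket concerns the power
  -- of `root + δ`, which is the same real because `δ` represents 0.
  root^≈x : root ^ suc d ≈ x
  root^≈x = x-y≈0⇒x≈y (tight ≮ ≯)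
    where
    ≮ : ¬ 0ℝ < root ^ suc d - x
    ≮ p = let c , 0<c , N , h = 0<-elim p
              n = N ℕ.⊔ N₀
              N≤n , N₀≤n = ⊔-max {N} ℕ.≤-refl
          in ℚ.<-irrefl ≡.refl (ℚ.<-≤-trans 0<c (ℚ.≤-trans (h n N≤n)
            (p≤q⇒p-q≤0 (subst (ℚ._≤ seq x n) (≡.sym (seq-^ root (suc d) n)) (rootSeq^≤x n N₀≤n)))))
    ≯ : ¬ 0ℝ < - (root ^ suc d - x)
    ≯ p = let p′ = 0<-resp-≈ (-‿cong (+-cong (Exp.^-congˡ (CommutativeRing.semiring ℝ-commutativeRing) (suc d) (≈-sym root+δ≈root)) (≈-refl { - x}))) p
              c , 0<c , N , h = 0<-elim p′
              n = N ℕ.⊔ N₀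
              N≤n , N₀≤n = ⊔-max {N} ℕ.≤-refl
          in ℚ.<-irrefl ≡.refl (ℚ.<-≤-trans 0<c (ℚ.≤-trans (h n N≤n) (ℚ.neg-antimono-≤
            (p≤q⇒0≤q-p (subst (seq x n ℚ.≤_) (≡.sym (seq-^ (root + δ) (suc d) n)) (ℚ.<⇒≤ (x<rootSeq+δ^ n N₀≤n)))))))

  0<root : 0ℝ < root
  0<root = let M , small = 1/1+-small h 0<h in
    0<-intro root h (N₀ ℕ.⊔ M) 0<h λ n le → let N₀≤n , M≤n = ⊔-max {N₀} le in
      ℚ.≮⇒≥ λ y<h → ℚ.<-irrefl ≡.refl (ℚ.<-≤-trans (x<rootSeq+δ^ n N₀≤n)
        (let 0≤y+δ = ℚ.+-mono-≤ (0≤rootSeq n) (ℚ.<⇒≤ (0<recip (suc n ℚ× 1ℚ) (0<1+n n)))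
             y+δ≤ = ℚ.<⇒≤ (subst (rootSeq n ℚ.+ 1/1+ n ℚ.<_) (half+half (1ℚ ℚ.⊓ c)) (ℚ.+-mono-< y<h (small n M≤n)))
         in ℚ.≤-trans (a≤1⇒a^1+n≤a d 0≤y+δ (ℚ.≤-trans y+δ≤ (ℚ.p⊓q≤p 1ℚ c)))
              (ℚ.≤-trans y+δ≤ (ℚ.≤-trans (ℚ.p⊓q≤q 1ℚ c) (c≤x n N₀≤n)))))
    where
    -- If the approximation were below `h` at a late index, adding `1/1+ n` would leave it at most
    -- min(1, c). Being at most 1, it would have a power no larger than itself, hence at most
    -- `c ≤ x`, against the upper bracket.
    h : ℚ
    h = (1ℚ ℚ.⊓ c) ℚ.* ½
    0<h : 0ℚ ℚ.< h
    0<h = half ([ (λ e → subst (0ℚ ℚ.<_) (≡.sym e) 0<1ℚ) , (λ e → subst (0ℚ ℚ.<_) (≡.sym e) 0<c) ]′ (ℚ.⊓-sel 1ℚ c))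

-- The commutative ring ℂ

module ℝ-Ring = CommutativeRing ℝ-commutativeRing

-- Since `x` is the sum of `x + y` and `- y`, one of these is positive, and the second is excluded.
0<x+nonneg : ∀ {x y} → 0ℝ < x → ¬ 0ℝ < - y → 0ℝ < x + y
0<x+nonneg {x} {y} 0<x 0≤y =
  [ (λ p → p) , (λ p → ⊥-elim (0≤y p)) ]′ (0<x+y⇒0<x∨0<y (0<-resp-≈ (split x y) 0<x))
  where
  open ℝ-Solver
  split : ∀ x y → x ≈ (x + y) + - y
  split = solve 2 (λ x y → x := (x :+ y) :+ :- y) ≈-refl

0≮x+y : ∀ {x y} → ¬ 0ℝ < x → ¬ 0ℝ < y → ¬ 0ℝ < x + y
0≮x+y ¬p ¬q 0<x+y = [ ¬p , ¬q ]′ (0<x+y⇒0<x∨0<y 0<x+y)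

pos*nonneg : ∀ {x y} → 0ℝ < x → ¬ 0ℝ < - y → ¬ 0ℝ < - (x * y)
pos*nonneg {x} {y} 0<x 0≤y p = 0≤y (0<x*y⇒0<y 0<x (0<-resp-≈ (lemma x y) p))
  where
  open ℝ-Solver
  lemma : ∀ x y → - (x * y) ≈ x * - y
  lemma = solve 2 (λ x y → :- (x :* y) := x :* :- y) ≈-refl

ℂ-commutativeRing : CommutativeRing 0ℓ 0ℓ
ℂ-commutativeRing = record
  { Carrier = ℂ ; _≈_ = _≈ᶜ_ ; _+_ = R._+_ ; _*_ = R._*_ ; -_ = R.-_ ; 0# = R.0# ; 1# = R.1#
  ; isCommutativeRing = record
    { isRing = record
      { +-isAbelianGroup = record
        { isGroup = record
          { isMonoid = record
            { isSemigroup = record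
              { isMagma = record
                { isEquivalence = record
                  { refl  = mk≈ᶜ ≈-refl ≈-refl
                  ; sym   = λ p → mk≈ᶜ (≈-sym (re≈ p)) (≈-sym (im≈ p))
                  ; trans = λ p q → mk≈ᶜ (≈-trans (re≈ p) (re≈ q)) (≈-trans (im≈ p) (im≈ q)) }
                ; ∙-cong = λ p q → mk≈ᶜ (+-cong (re≈ p) (re≈ q)) (+-cong (im≈ p) (im≈ q)) }
              ; assoc = λ x y z → mk≈ᶜ (ℝ-Ring.+-assoc (re x) (re y) (re z)) (ℝ-Ring.+-assoc (im x) (im y) (im z)) }
            ; identity = (λ x → mk≈ᶜ (ℝ-Ring.+-identityˡ (re x)) (ℝ-Ring.+-identityˡ (im x)))
                       , (λ x → mk≈ᶜ (ℝ-Ring.+-identityʳ (re x)) (ℝ-Ring.+-identityʳ (im x))) }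
          ; inverse = (λ x → mk≈ᶜ (ℝ-Ring.-‿inverseˡ (re x)) (ℝ-Ring.-‿inverseˡ (im x)))
                    , (λ x → mk≈ᶜ (ℝ-Ring.-‿inverseʳ (re x)) (ℝ-Ring.-‿inverseʳ (im x)))
          ; ⁻¹-cong = λ p → mk≈ᶜ (-‿cong (re≈ p)) (-‿cong (im≈ p)) }
        ; comm = λ x y → mk≈ᶜ (ℝ-Ring.+-comm (re x) (re y)) (ℝ-Ring.+-comm (im x) (im y)) }
      ; *-cong = λ p q → mk≈ᶜ
          (+-cong (*-cong (re≈ p) (re≈ q)) (-‿cong (*-cong (im≈ p) (im≈ q))))
          (+-cong (*-cong (re≈ p) (im≈ q)) (*-cong (im≈ p) (re≈ q)))
      ; *-assoc = λ x y z → mk≈ᶜ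
          (solve 6 (λ a b c d e f → (a :* c :- b :* d) :* e :- (a :* d :+ b :* c) :* f
                                 := a :* (c :* e :- d :* f) :- b :* (c :* f :+ d :* e))
            ≈-refl (re x) (im x) (re y) (im y) (re z) (im z))
          (solve 6 (λ a b c d e f → (a :* c :- b :* d) :* f :+ (a :* d :+ b :* c) :* e
                                 := a :* (c :* f :+ d :* e) :+ b :* (c :* e :- d :* f))
            ≈-refl (re x) (im x) (re y) (im y) (re z) (im z))
      ; *-identity =
          (λ x → mk≈ᶜ (solve 2 (λ a b → con 1ℚ :* a :- con 0ℚ :* b := a) ≈-refl (re x) (im x))
                       (solve 2 (λ a b → con 1ℚ :* b :+ con 0ℚ :* a := b) ≈-refl (re x) (im x)))
        , (λ x → mk≈ᶜ (solve 2 (λ a b → a :* con 1ℚ :- b :* con 0ℚ := a) ≈-refl (re x) (im x))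
                       (solve 2 (λ a b → a :* con 0ℚ :+ b :* con 1ℚ := b) ≈-refl (re x) (im x)))
      ; distrib =
          (λ x y z → mk≈ᶜ
            (solve 6 (λ a b c d e f → a :* (c :+ e) :- b :* (d :+ f) := (a :* c :- b :* d) :+ (a :* e :- b :* f))
              ≈-refl (re x) (im x) (re y) (im y) (re z) (im z))
            (solve 6 (λ a b c d e f → a :* (d :+ f) :+ b :* (c :+ e) := (a :* d :+ b :* c) :+ (a :* f :+ b :* e))
              ≈-refl (re x) (im x) (re y) (im y) (re z) (im z)))
        , (λ x y z → mk≈ᶜ
            (solve 6 (λ a b c d e f → (c :+ e) :* a :- (d :+ f) :* b := (c :* a :- d :* b) :+ (e :* a :- f :* b))
              ≈-refl (re x) (im x) (re y) (im y) (re z) (im z))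
            (solve 6 (λ a b c d e f → (c :+ e) :* b :+ (d :+ f) :* a := (c :* b :+ d :* a) :+ (e :* b :+ f :* a))
              ≈-refl (re x) (im x) (re y) (im y) (re z) (im z))) }
    ; *-comm = λ x y → mk≈ᶜ
        (solve 4 (λ a b c d → a :* c :- b :* d := c :* a :- d :* b) ≈-refl (re x) (im x) (re y) (im y))
        (solve 4 (λ a b c d → a :* d :+ b :* c := c :* b :+ d :* a) ≈-refl (re x) (im x) (re y) (im y)) } }
  where
  module R = RawRing ℂ-rawRing
  open ℝ-Solver

module C = CommutativeRing ℂ-commutativeRing

fromℝ-cong : ∀ {x y} → x ≈ y → fromℝ x ≈ᶜ fromℝ y
fromℝ-cong x≈y = mk≈ᶜ x≈y ≈-refl

fromℝ-* : ∀ x y → fromℝ (x * y) ≈ᶜ fromℝ x C.* fromℝ y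
fromℝ-* x y = mk≈ᶜ
  (solve 2 (λ x y → x :* y := x :* y :- con 0ℚ :* con 0ℚ) ≈-refl x y)
  (solve 2 (λ x y → con 0ℚ := x :* con 0ℚ :+ con 0ℚ :* y) ≈-refl x y)
  where open ℝ-Solver

fromℝ-+ : ∀ x y → fromℝ (x + y) ≈ᶜ fromℝ x C.+ fromℝ y
fromℝ-+ x y = mk≈ᶜ ≈-refl (≈-sym (ℝ-Ring.+-identityˡ 0ℝ))

fromℚᶜ-homomorphism : CommutativeRing.rawRing ℚ.+-*-commutativeRing
                     -Raw-AlmostCommutative⟶ fromCommutativeRing ℂ-commutativeRing
fromℚᶜ-homomorphism = record
  { ⟦_⟧ = λ q → fromℝ (fromℚ q)
  ; +-homo = λ p q → C.trans (fromℝ-cong (termwise λ _ → ≡.refl)) (fromℝ-+ (fromℚ p) (fromℚ q))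
  ; *-homo = λ p q → C.trans (fromℝ-cong (termwise λ _ → ≡.refl)) (fromℝ-* (fromℚ p) (fromℚ q))
  ; -‿homo = λ _ → mk≈ᶜ (termwise λ _ → ≡.refl) (termwise λ _ → ≡.refl)
  ; 0-homo = C.refl
  ; 1-homo = C.refl }

fromℚᶜ-weaklyDecidable : ∀ p q → Maybe (fromℝ (fromℚ p) ≈ᶜ fromℝ (fromℚ q))
fromℚᶜ-weaklyDecidable p q with p ℚ.≟ q
... | yes ≡.refl = just C.refl
... | no  _      = nothing

module ℂ-Solver = RingSolver (CommutativeRing.rawRing ℚ.+-*-commutativeRing)
  (fromCommutativeRing ℂ-commutativeRing) fromℚᶜ-homomorphism fromℚᶜ-weaklyDecidable

-- Squared moduli

norm² : ℂ → ℝ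
norm² z = re z * re z + im z * im z

norm²-cong : ∀ {z w} → z ≈ᶜ w → norm² z ≈ norm² w
norm²-cong p = +-cong (*-cong (re≈ p) (re≈ p)) (*-cong (im≈ p) (im≈ p))

norm²-* : ∀ z w → norm² (z C.* w) ≈ norm² z * norm² w
norm²-* z w = solve 4 (λ a b c d →
    (a :* c :- b :* d) :* (a :* c :- b :* d) :+ (a :* d :+ b :* c) :* (a :* d :+ b :* c)
    := (a :* a :+ b :* b) :* (c :* c :+ d :* d)) ≈-refl (re z) (im z) (re w) (im w)
  where open ℝ-Solver

norm²-neg : ∀ z → norm² (C.- z) ≈ norm² z
norm²-neg z = solve 2 (λ a b → (:- a) :* (:- a) :+ (:- b) :* (:- b) := a :* a :+ b :* b)
  ≈-refl (re z) (im z)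
  where open ℝ-Solver

norm²-fromℝ : ∀ x → norm² (fromℝ x) ≈ x * x
norm²-fromℝ x = solve 1 (λ x → x :* x :+ con 0ℚ :* con 0ℚ := x :* x) ≈-refl x
  where open ℝ-Solver

0≮-norm² : ∀ z → ¬ 0ℝ < - norm² z
0≮-norm² z p = 0≮x+y (0≮-x² (re z)) (0≮-x² (im z)) (0<-resp-≈ (split (re z * re z) (im z * im z)) p)
  where
  open ℝ-Solver
  split : ∀ x y → - (x + y) ≈ - x + - y
  split = solve 2 (λ x y → :- (x :+ y) := :- x :+ :- y) ≈-refl

x²+y²≈0⇒x≈0 : ∀ {x y} → x * x + y * y ≈ 0ℝ → x ≈ 0ℝ
x²+y²≈0⇒x≈0 {x} {y} h = tight
  (λ 0<x → 0<⇒≉0 (0<x+nonneg (0<x*y 0<x 0<x) (0≮-x² y)) h)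
  (λ 0<-x → 0<⇒≉0 (0<x+nonneg (0<-resp-≈ (lemma x) (0<x*y 0<-x 0<-x)) (0≮-x² y)) h)
  where
  open ℝ-Solver
  lemma : ∀ x → - x * - x ≈ x * x
  lemma = solve 1 (λ x → :- x :* :- x := x :* x) ≈-refl

norm²≈0⇒≈0 : ∀ {z} → norm² z ≈ 0ℝ → z ≈ᶜ C.0#
norm²≈0⇒≈0 {z} h = mk≈ᶜ (x²+y²≈0⇒x≈0 h) (x²+y²≈0⇒x≈0 (≈-trans (ℝ-Ring.+-comm _ _) h))

x+y≈0⇒norm²≈ : ∀ {z w} → z C.+ w ≈ᶜ C.0# → norm² z ≈ norm² w
x+y≈0⇒norm²≈ {z} {w} h = ≈-trans (norm²-cong (C.trans (split z w) (C.trans (C.+-congʳ h) (C.+-identityˡ (C.- w)))))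
  (norm²-neg w)
  where
  open ℂ-Solver
  split : ∀ z w → z ≈ᶜ (z C.+ w) C.+ C.- w
  split = solve 2 (λ z w → z := (z :+ w) :+ :- w) C.refl

-- A positive lower bound cannot be extracted from `z ≠ 0`; only its absence can be refuted. This is
-- enough where the goal is itself a negation.
≉0⇒¬¬0<norm² : ∀ {z} → ¬ z ≈ᶜ C.0# → ¬ ¬ 0ℝ < norm² z
≉0⇒¬¬0<norm² {z} z≉0 ¬0<z = z≉0 (norm²≈0⇒≈0 (tight ¬0<z (0≮-norm² z)))

*-≉0 : ∀ {z w} → ¬ z ≈ᶜ C.0# → ¬ w ≈ᶜ C.0# → ¬ z C.* w ≈ᶜ C.0#
*-≉0 {z} {w} z≉0 w≉0 zw≈0 = ≉0⇒¬¬0<norm² z≉0 λ 0<z → ≉0⇒¬¬0<norm² w≉0 λ 0<w →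
  0<⇒≉0 (0<x*y 0<z 0<w) (≈-trans (≈-sym (norm²-* z w)) (≈-trans (norm²-cong zw≈0)
    (solve 0 (con 0ℚ :* con 0ℚ :+ con 0ℚ :* con 0ℚ := con 0ℚ) ≈-refl)))
  where open ℝ-Solver

-- A bilinear form in homogeneous coordinates (ξ : x), (η : y).
form : ℂ → ℂ → ℂ → ℂ → ℂ → ℂ → ℂ → ℂ → ℂ
form a b c e x ξ y η = a C.* (ξ C.* η) C.+ b C.* (x C.* η) C.+ c C.* (ξ C.* y) C.+ e C.* (x C.* y)

-- In the coordinates X = x/ξ, Y = y/η: the polynomial a + bX + cY + eXY has no zero in the open
-- unit bidisc.
Nonvanishing : ℂ → ℂ → ℂ → ℂ → Set
Nonvanishing a b c e = ∀ x ξ y η → norm² x < norm² ξ → norm² y < norm² η → ¬ form a b c e x ξ y η ≈ᶜ C.0#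

-- (ξ : x) determines the point (−(cξ + ex) : aξ + bx) at which the form vanishes.
nonvanishing⇒≮ : ∀ a b c e → Nonvanishing a b c e → ∀ x ξ → norm² x < norm² ξ →
  ¬ 0ℝ < norm² (c C.* ξ C.+ e C.* x) - norm² (a C.* ξ C.+ b C.* x)
nonvanishing⇒≮ a b c e nv x ξ x<ξ p = nv x ξ (a C.* ξ C.+ b C.* x) (C.- (c C.* ξ C.+ e C.* x)) x<ξ
  (0<-⇒< (0<-resp-≈ (+-cong (≈-sym (norm²-neg _)) ≈-refl) p))
  (solve 6 (λ a b c e x ξ → let y = a :* ξ :+ b :* x ; η = :- (c :* ξ :+ e :* x) in
      a :* (ξ :* η) :+ b :* (x :* η) :+ c :* (ξ :* y) :+ e :* (x :* y) := con 0ℚ) C.refl a b c e x ξ)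
  where open ℂ-Solver

-- Adding the values at `x` and `- x` cancels the cross term between `a` and `b`, so only their
-- squared moduli survive.
parallelogram : ∀ a b x ξ →
  norm² (a C.* fromℝ ξ C.+ b C.* fromℝ x) + norm² (a C.* fromℝ ξ C.+ b C.* fromℝ (- x)) ≈
  2ℝ * (norm² a * (ξ * ξ) + norm² b * (x * x))
parallelogram a b x ξ = solve 6 (λ a₁ a₂ b₁ b₂ x ξ →
    let re⁺ = (a₁ :* ξ :- a₂ :* con 0ℚ) :+ (b₁ :* x :- b₂ :* con 0ℚ)
        im⁺ = (a₁ :* con 0ℚ :+ a₂ :* ξ) :+ (b₁ :* con 0ℚ :+ b₂ :* x)
        re⁻ = (a₁ :* ξ :- a₂ :* con 0ℚ) :+ (b₁ :* (:- x) :- b₂ :* con 0ℚ)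
        im⁻ = (a₁ :* con 0ℚ :+ a₂ :* ξ) :+ (b₁ :* con 0ℚ :+ b₂ :* (:- x))
    in (re⁺ :* re⁺ :+ im⁺ :* im⁺) :+ (re⁻ :* re⁻ :+ im⁻ :* im⁻)
       := con (1ℚ ℚ.+ 1ℚ) :* ((a₁ :* a₁ :+ a₂ :* a₂) :* (ξ :* ξ) :+ (b₁ :* b₁ :+ b₂ :* b₂) :* (x :* x)))
  ≈-refl (re a) (im a) (re b) (im b) x ξ
  where open ℝ-Solver

-- The Lee–Yang theorem

open GraphExpansion ℂ-commutativeRing using (∑-list; at; attach; module Partition)
open RawSemiringOps (RawRing.rawSemiring ℂ-rawRing) using (product)

nonvanishing-swap : ∀ {a b c e} → Nonvanishing a b c e → Nonvanishing a c b e
nonvanishing-swap {a} {b} {c} {e} nv x ξ y η x<ξ y<η h = nv y η x ξ y<η x<ξ (C.trans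
  (solve 8 (λ a b c e x ξ y η →
    a :* (η :* ξ) :+ b :* (y :* ξ) :+ c :* (η :* x) :+ e :* (y :* x)
    := a :* (ξ :* η) :+ c :* (x :* η) :+ b :* (ξ :* y) :+ e :* (x :* y)) C.refl a b c e x ξ y η) h)
  where open ℂ-Solver

nonvanishing⇒norm²≮ : ∀ {a b c e} → Nonvanishing a b c e → ∀ x ξ → x * x < ξ * ξ →
  ¬ 0ℝ < (norm² e * (x * x) - norm² a * (ξ * ξ)) * (2ℝ * 2ℝ) +
         2ℝ * (ξ * ξ - x * x) * (norm² b + norm² c)
nonvanishing⇒norm²≮ {a} {b} {c} {e} nv x ξ x<ξ p = 0≮x+y
  (0≮x+y (nonvanishing⇒≮ a b c e nv (fromℝ x) (fromℝ ξ) x<ξ⁺)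
         (nonvanishing⇒≮ a b c e nv (fromℝ (- x)) (fromℝ ξ) x<ξ⁻))
  (0≮x+y (nonvanishing⇒≮ a c b e (nonvanishing-swap nv) (fromℝ x) (fromℝ ξ) x<ξ⁺)
         (nonvanishing⇒≮ a c b e (nonvanishing-swap nv) (fromℝ (- x)) (fromℝ ξ) x<ξ⁻))
  (0<-resp-≈ (≈-sym total) p)
  where
  open ℝ-Solver
  x<ξ⁺ : norm² (fromℝ x) < norm² (fromℝ ξ)
  x<ξ⁺ = 0<-⇒< (0<-resp-≈ (+-cong (≈-sym (norm²-fromℝ ξ)) (-‿cong (≈-sym (norm²-fromℝ x)))) (<⇒0<- x<ξ))
  x<ξ⁻ : norm² (fromℝ (- x)) < norm² (fromℝ ξ)
  x<ξ⁻ = 0<-⇒< (0<-resp-≈ (+-cong ≈-refl (-‿cong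
    (solve 1 (λ x → x :* x :+ con 0ℚ :* con 0ℚ := (:- x) :* (:- x) :+ con 0ℚ :* con 0ℚ) ≈-refl x))) (<⇒0<- x<ξ⁺))
  regroup : ∀ p p′ q q′ r r′ s s′ →
    ((p - q) + (p′ - q′)) + ((r - s) + (r′ - s′)) ≈ ((p + p′) - (q + q′)) + ((r + r′) - (s + s′))
  regroup = solve 8 (λ p p′ q q′ r r′ s s′ →
    ((p :- q) :+ (p′ :- q′)) :+ ((r :- s) :+ (r′ :- s′)) := ((p :+ p′) :- (q :+ q′)) :+ ((r :+ r′) :- (s :+ s′))) ≈-refl
  simplify : ∀ A B C E X Ξ →
    (2ℝ * (C * Ξ + E * X) - 2ℝ * (A * Ξ + B * X)) + (2ℝ * (B * Ξ + E * X) - 2ℝ * (A * Ξ + C * X)) ≈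
    (E * X - A * Ξ) * (2ℝ * 2ℝ) + 2ℝ * (Ξ - X) * (B + C)
  simplify = solve 6 (λ A B C E X Ξ → let t = con (1ℚ ℚ.+ 1ℚ) in
    (t :* (C :* Ξ :+ E :* X) :- t :* (A :* Ξ :+ B :* X)) :+ (t :* (B :* Ξ :+ E :* X) :- t :* (A :* Ξ :+ C :* X))
    := (E :* X :- A :* Ξ) :* (t :* t) :+ t :* (Ξ :- X) :* (B :+ C)) ≈-refl
  total = ≈-trans
    (regroup (norm² (c C.* fromℝ ξ C.+ e C.* fromℝ x)) (norm² (c C.* fromℝ ξ C.+ e C.* fromℝ (- x)))
             (norm² (a C.* fromℝ ξ C.+ b C.* fromℝ x)) (norm² (a C.* fromℝ ξ C.+ b C.* fromℝ (- x)))
             (norm² (b C.* fromℝ ξ C.+ e C.* fromℝ x)) (norm² (b C.* fromℝ ξ C.+ e C.* fromℝ (- x)))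
             (norm² (a C.* fromℝ ξ C.+ c C.* fromℝ x)) (norm² (a C.* fromℝ ξ C.+ c C.* fromℝ (- x))))
    (≈-trans
      (+-cong (+-cong (parallelogram c e x ξ) (-‿cong (parallelogram a b x ξ)))
              (+-cong (parallelogram b e x ξ) (-‿cong (parallelogram a c x ξ))))
      (simplify (norm² a) (norm² b) (norm² c) (norm² e) (x * x) (ξ * ξ)))

nonvanishing⇒≉0 : ∀ {a b c e} → Nonvanishing a b c e → ¬ a ≈ᶜ C.0#
nonvanishing⇒≉0 {a} {b} {c} {e} nv a≈0 = nv C.0# C.1# C.0# C.1# 0<1ᶜ 0<1ᶜ
  (C.trans (solve 4 (λ a b c e → let o = con 0ℚ ; i = con 1ℚ in
    a :* (i :* i) :+ b :* (o :* i) :+ c :* (i :* o) :+ e :* (o :* o) := a) C.refl a b c e) a≈0)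
  where
  open ℂ-Solver
  0<1ᶜ : norm² C.0# < norm² C.1#
  0<1ᶜ = 0<-⇒< (0<-resp-≈ (R.solve 0 ((R.con 1ℚ) R.:= (R.con 1ℚ R.:* R.con 1ℚ R.:+ R.con 0ℚ R.:* R.con 0ℚ) R.:- (R.con 0ℚ R.:* R.con 0ℚ R.:+ R.con 0ℚ R.:* R.con 0ℚ)) ≈-refl) 0<1)
    where module R = ℝ-Solver

-- Asano contraction.  With m = |w|², n = |ω|² the previous bound at (ξ : x) = (2n : m + n) gives
-- |e|²(m + n)² ≤ 4n²|a|², while ωa + we = 0 gives n|a|² = m|e|²; hence |e|²(n − m)² ≤ 0.
contraction : ∀ {a b c e} → Nonvanishing a b c e → ∀ w ω → norm² w < norm² ω →
  ¬ ω C.* a C.+ w C.* e ≈ᶜ C.0#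
contraction {a} {b} {c} {e} nv w ω w<ω h = nonvanishing⇒≉0 nv (norm²≈0⇒≈0 (A≈0))
  where
  open ℝ-Solver
  m = norm² w
  n = norm² ω
  A = norm² a
  E = norm² e
  0<n-m : 0ℝ < n - m
  0<n-m = <⇒0<- w<ω
  0<n+m : 0ℝ < n + m
  0<n+m = 0<-resp-≈ (solve 2 (λ m n → (n :- m) :+ m :+ m := n :+ m) ≈-refl m n)
    (0<x+nonneg (0<x+nonneg 0<n-m (0≮-norm² w)) (0≮-norm² w))
  0<n : 0ℝ < n
  0<n = 0<-resp-≈ (solve 2 (λ m n → (n :- m) :+ m := n) ≈-refl m n) (0<x+nonneg 0<n-m (0≮-norm² w))
  nA≈mE : n * A ≈ m * E
  nA≈mE = ≈-trans (≈-sym (norm²-* ω a)) (≈-trans (x+y≈0⇒norm²≈ h) (norm²-* w e))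
  x = m + n
  ξ = n + n
  0<ξ²-x² : 0ℝ < ξ * ξ - x * x
  0<ξ²-x² = 0<-resp-≈ (solve 2 (λ m n → (n :- m) :* ((n :+ m) :+ (n :+ n))
    := (n :+ n) :* (n :+ n) :- (m :+ n) :* (m :+ n)) ≈-refl m n) (0<x*y 0<n-m (0<x+y 0<n+m (0<x+y 0<n 0<n)))
  0≤B+C : ¬ 0ℝ < - (norm² b + norm² c)
  0≤B+C p = 0≮x+y (0≮-norm² b) (0≮-norm² c) (0<-resp-≈
    (solve 2 (λ B C → :- (B :+ C) := :- B :+ :- C) ≈-refl (norm² b) (norm² c)) p)
  Eξ²≡ : (n - m) * (n - m) * E ≈ E * (x * x) - A * (ξ * ξ)
  Eξ²≡ = ≈-trans
    (solve 3 (λ m n E → (n :- m) :* (n :- m) :* E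
      := E :* ((m :+ n) :* (m :+ n)) :- (con 1ℚ :+ con 1ℚ) :* (con 1ℚ :+ con 1ℚ) :* n :* (m :* E)) ≈-refl m n E)
    (≈-trans (+-cong ≈-refl (-‿cong (*-cong ≈-refl (≈-sym nA≈mE))))
      (solve 4 (λ m n A E →
        E :* ((m :+ n) :* (m :+ n)) :- (con 1ℚ :+ con 1ℚ) :* (con 1ℚ :+ con 1ℚ) :* n :* (n :* A)
        := E :* ((m :+ n) :* (m :+ n)) :- A :* ((n :+ n) :* (n :+ n))) ≈-refl m n A E))
  ¬0<E : ¬ 0ℝ < E
  ¬0<E 0<E = nonvanishing⇒norm²≮ nv x ξ (0<-⇒< 0<ξ²-x²) (0<x+nonneg
    (0<x*y (0<-resp-≈ Eξ²≡ (0<x*y (0<x*y 0<n-m 0<n-m) 0<E)) (0<x*y 0<2 0<2))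
    (pos*nonneg (0<x*y 0<2 0<ξ²-x²) 0≤B+C))
  A≈0 : A ≈ 0ℝ
  A≈0 = tight (λ 0<A → 0<⇒≉0 (0<x*y 0<n 0<A) (≈-trans nA≈mE
    (≈-trans (*-cong ≈-refl (tight ¬0<E (0≮-norm² e))) (ℝ-Ring.zeroʳ m)))) (0≮-norm² a)

product-≉0 : ∀ {n} (x : Vector ℂ n) → (∀ v → ¬ x v ≈ᶜ C.0#) → ¬ product x ≈ᶜ C.0#
product-≉0 {zero}  x x≉0 h = 0<⇒≉0 0<1 (re≈ h)
product-≉0 {suc n} x x≉0 = *-≉0 (x≉0 zero) (product-≉0 (λ v → x (suc v)) λ v → x≉0 (suc v))

-- Exchanging the states exchanges `α` and `β`. The dominant state `i` and the other state `j` are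
-- parameters, so that the module can be used a second time with both pairs exchanged.
module LeeYang
  (α β : Fin 2 → ℝ) (i j : Fin 2)
  (sum₂ : ∀ f → ∑-list (allFin 2) f ≈ᶜ f i C.+ f j)
  (βi≈αj : β i ≈ α j) (βj≈αi : β j ≈ α i) (0<αj : 0ℝ < α j) (αj<αi : α j < α i)
  (κ : ℝ) (0<κ : 0ℝ < κ)
  where

  open Partition (λ k → fromℝ (α k)) (λ k → fromℝ (β k))

  -- The ratio g j / g i lies in the open unit disc. This is closed under products and excludes g i
  -- + g j = 0.
  Dominated : (Fin 2 → ℂ) → Set
  Dominated g = 0ℝ < norm² (g i) - norm² (g j)

  -- The product of κ and the pendant factors at a vertex: the second case is that of no factor.
  VertexWeight : (Fin 2 → ℂ) → Set
  VertexWeight g = Dominated g ⊎ (∀ k → g k ≈ᶜ fromℝ κ)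

  norm²-pendant : ∀ α β x ξ → norm² (fromℝ α C.* ξ C.+ fromℝ β C.* x) ≈
    α * α * norm² ξ + β * β * norm² x + 2ℝ * (α * β) * (re ξ * re x + im ξ * im x)
  norm²-pendant α β x ξ = solve 6 (λ α β x₁ x₂ ξ₁ ξ₂ →
      let r = (α :* ξ₁ :- con 0ℚ :* ξ₂) :+ (β :* x₁ :- con 0ℚ :* x₂)
          s = (α :* ξ₂ :+ con 0ℚ :* ξ₁) :+ (β :* x₂ :+ con 0ℚ :* x₁)
      in r :* r :+ s :* s := α :* α :* (ξ₁ :* ξ₁ :+ ξ₂ :* ξ₂) :+ β :* β :* (x₁ :* x₁ :+ x₂ :* x₂)
           :+ con (1ℚ ℚ.+ 1ℚ) :* (α :* β) :* (ξ₁ :* x₁ :+ ξ₂ :* x₂))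
    ≈-refl α β (re x) (im x) (re ξ) (im ξ)
    where open ℝ-Solver

  -- With s = α i, q = α j and X = x/ξ the ratio is (q + sX) / (s + qX), a Möbius map that preserves
  -- the unit disc for s > q > 0. In terms of moduli, the cross terms at `i` and `j` agree and the
  -- difference is (s² - q²)(|ξ|² - |x|²).
  pendant-dominated : ∀ x ξ → norm² x < norm² ξ → Dominated (pendant x ξ)
  pendant-dominated x ξ x<ξ = 0<-resp-≈ (≈-sym (≈-trans
      (+-cong (norm²-pendant (α i) (β i) x ξ) (-‿cong (norm²-pendant (α j) (β j) x ξ)))
      (≈-trans (+-cong
        (+-cong (+-cong ≈-refl (*-cong (*-cong βi≈αj βi≈αj) ≈-refl)) (*-cong (*-cong ≈-refl (*-cong ≈-refl βi≈αj)) ≈-refl))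
        (-‿cong (+-cong (+-cong ≈-refl (*-cong (*-cong βj≈αi βj≈αi) ≈-refl)) (*-cong (*-cong ≈-refl (*-cong ≈-refl βj≈αi)) ≈-refl))))
        (factor (α i) (α j) (norm² x) (norm² ξ) (re ξ * re x + im ξ * im x)))))
    (0<x*y (0<x*y (<⇒0<- αj<αi) 0<αi+αj) (<⇒0<- x<ξ))
    where
    open ℝ-Solver
    0<αi+αj : 0ℝ < α i + α j
    0<αi+αj = 0<-resp-≈ (solve 2 (λ p q → (p :- q) :+ (q :+ q) := p :+ q) ≈-refl (α i) (α j))
      (0<x+y (<⇒0<- αj<αi) (0<x+y 0<αj 0<αj))
    factor : ∀ p q X Ξ c →
      (p * p * Ξ + q * q * X + 2ℝ * (p * q) * c) - (q * q * Ξ + p * p * X + 2ℝ * (q * p) * c) ≈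
      (p - q) * (p + q) * (Ξ - X)
    factor = solve 5 (λ p q X Ξ c → let t = con (1ℚ ℚ.+ 1ℚ) in
      (p :* p :* Ξ :+ q :* q :* X :+ t :* (p :* q) :* c) :- (q :* q :* Ξ :+ p :* p :* X :+ t :* (q :* p) :* c)
      := (p :- q) :* (p :+ q) :* (Ξ :- X)) ≈-refl

  attach-dominated : ∀ {g h} → VertexWeight g → Dominated h → Dominated (λ k → g k C.* h k)
  attach-dominated {g} {h} (inj₁ g-dom) h-dom = 0<-resp-≈
    (≈-trans (rearrange (norm² (g i)) (norm² (g j)) (norm² (h i)) (norm² (h j)))
      (+-cong (≈-sym (norm²-* (g i) (h i))) (-‿cong (≈-sym (norm²-* (g j) (h j))))))
    (0<x+nonneg (0<x*y g-dom 0<hi) (pos*nonneg h-dom (0≮-norm² (g j))))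
    where
    open ℝ-Solver
    0<hi : 0ℝ < norm² (h i)
    0<hi = 0<-resp-≈ (solve 2 (λ p q → (p :- q) :+ q := p) ≈-refl (norm² (h i)) (norm² (h j)))
      (0<x+nonneg h-dom (0≮-norm² (h j)))
    rearrange : ∀ a b c d → (a - b) * c + (c - d) * b ≈ a * c - b * d
    rearrange = solve 4 (λ a b c d → (a :- b) :* c :+ (c :- d) :* b := a :* c :- b :* d) ≈-refl
  attach-dominated {g} {h} (inj₂ g≈κ) h-dom = 0<-resp-≈
    (≈-trans (rearrange (κ * κ) (norm² (h i)) (norm² (h j))) (+-cong (scaled i) (-‿cong (scaled j))))
    (0<x*y (0<x*y 0<κ 0<κ) h-dom)
    where
    open ℝ-Solver
    rearrange : ∀ k c d → k * (c - d) ≈ k * c - k * d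
    rearrange = solve 3 (λ k c d → k :* (c :- d) := k :* c :- k :* d) ≈-refl
    scaled : ∀ k → κ * κ * norm² (h k) ≈ norm² (g k C.* h k)
    scaled k = ≈-sym (≈-trans (norm²-* (g k) (h k))
      (*-cong (≈-trans (norm²-cong (g≈κ k)) (norm²-fromℝ κ)) ≈-refl))

  attach-weight : ∀ {g h} s → VertexWeight g → Dominated h → VertexWeight (λ k → g k C.* at s (h k))
  attach-weight {g} {h} true  g-weight h-dom = inj₁ (attach-dominated {g} {h} g-weight h-dom)
  attach-weight {g} {h} false g-weight h-dom =
    [ (λ g-dom → inj₁ (0<-resp-≈ (+-cong (norm²-cong (unit i)) (-‿cong (norm²-cong (unit j)))) g-dom))
    , (λ g≈κ → inj₂ λ k → C.trans (C.sym (unit k)) (g≈κ k))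
    ]′ g-weight
    where
    unit : ∀ k → g k ≈ᶜ g k C.* C.1#
    unit k = C.sym (C.*-identityʳ (g k))

  -- A vanishing sum would give both states equal moduli, against domination. A vertex without
  -- pendant factors contributes `κ + κ`, which is positive.
  weight-≉0 : ∀ {g} → VertexWeight g → ¬ ∑-list (allFin 2) g ≈ᶜ C.0#
  weight-≉0 {g} (inj₁ g-dom) h = 0<⇒≉0 g-dom (≈-trans
    (+-cong (x+y≈0⇒norm²≈ (C.trans (C.sym (sum₂ g)) h)) ≈-refl) (ℝ-Ring.-‿inverseʳ (norm² (g j))))
  weight-≉0 {g} (inj₂ g≈κ) h = 0<⇒≉0 (0<x+y 0<κ 0<κ)
    (re≈ (C.trans (C.sym (C.trans (sum₂ g) (C.+-cong (g≈κ i) (g≈κ j)))) h))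

  -- Cut the first edge uv, leaving pendant half-edges (ξ : x) at u and (η : y) at v: by induction the
  -- resulting bilinear form does not vanish, and its contraction is the partition function.
  partition-≉0 : ∀ {n} m (ends : Fin m → Fin n × Fin n) g → (∀ v → VertexWeight (g v)) →
    ∀ w ω → norm² w < norm² ω → ¬ partition m ends g w ω ≈ᶜ C.0#
  partition-≉0 {n} zero ends g g-weight w ω w<ω h =
    product-≉0 (λ v → ∑-list (allFin 2) (g v)) (λ v → weight-≉0 (g-weight v))
      (C.trans (C.sym (partition-without-edges ends g w ω)) h)
  partition-≉0 {n} (suc m) ends g g-weight w ω w<ω h = contraction
    {cutEdge ends g w ω αᶜ αᶜ} {cutEdge ends g w ω βᶜ αᶜ} {cutEdge ends g w ω αᶜ βᶜ} {cutEdge ends g w ω βᶜ βᶜ}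
    nonvanishing w ω w<ω (C.trans (C.sym (partition-contract ends g w ω)) h)
    where
    αᶜ βᶜ : Fin 2 → ℂ
    αᶜ k = fromℝ (α k)
    βᶜ k = fromℝ (β k)
    u v : Fin n
    u = proj₁ (ends zero)
    v = proj₂ (ends zero)
    nonvanishing : Nonvanishing (cutEdge ends g w ω αᶜ αᶜ) (cutEdge ends g w ω βᶜ αᶜ)
                                (cutEdge ends g w ω αᶜ βᶜ) (cutEdge ends g w ω βᶜ βᶜ)
    nonvanishing x ξ y η x<ξ y<η vanishes = partition-≉0 m (λ e → ends (suc e)) g″ g″-weight w ω w<ω
      (C.trans (partition-cut ends g w ω x ξ y η) vanishes)
      where
      g′ g″ : Fin n → Fin 2 → ℂ
      g′ = attach u (pendant x ξ) g
      g″ = attach v (pendant y η) g′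
      g′-weight : ∀ v → VertexWeight (g′ v)
      g′-weight v = attach-weight {g v} {pendant x ξ} (does (v Fin.≟ u)) (g-weight v) (pendant-dominated x ξ x<ξ)
      g″-weight : ∀ v → VertexWeight (g″ v)
      g″-weight w = attach-weight {g′ w} {pendant y η} (does (w Fin.≟ v)) (g′-weight w) (pendant-dominated y η y<η)

-- The decomposition of N

0<x+y∧0<x*y⇒0<x×0<y : ∀ {x y} → 0ℝ < x + y → 0ℝ < x * y → 0ℝ < x × 0ℝ < y
0<x+y∧0<x*y⇒0<x×0<y {x} {y} p q =
  [ (λ 0<x → 0<x , 0<x*y⇒0<y 0<x q)
  , (λ 0<y → 0<x*y⇒0<y 0<y (0<-resp-≈ (ℝ-Ring.*-comm x y) q) , 0<y) ]′ (0<x+y⇒0<x∨0<y p)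

sqrt : ∀ x → 0ℝ < x → Σ ℝ λ y → 0ℝ < y × y * y ≈ x
sqrt x 0<x = root , 0<root , ≈-trans (*-cong ≈-refl (≈-sym (ℝ-Ring.*-identityʳ root))) root^≈x
  where open Root x 0<x 1

*-cancelˡ : ∀ {c x y} → 0ℝ < c → c * x ≈ c * y → x ≈ y
*-cancelˡ {c} {x} {y} 0<c cx≈cy = ≈-trans (invert x) (≈-trans (*-cong ≈-refl cx≈cy) (≈-sym (invert y)))
  where
  open ℝ-Solver
  invert : ∀ x → x ≈ inv c 0<c * (c * x)
  invert x = ≈-trans (≈-sym (ℝ-Ring.*-identityˡ x)) (≈-trans (*-cong (≈-sym (x*inv≈1 c 0<c)) ≈-refl)
    (solve 3 (λ c d x → c :* d :* x := d :* (c :* x)) ≈-refl c (inv c 0<c) x))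

½ℝ : ℝ
½ℝ = fromℚ ½

record Factorisation (A B C : ℝ) : Set where
  field
    R s q : ℝ
    0<R   : 0ℝ < R
    0<q   : 0ℝ < q
    q<s   : q < s
    A≈    : A ≈ R * R * (s * s) + q * q
    B≈    : B ≈ R * R * (q * q) + s * s
    C≈    : C ≈ (R * R + 1ℝ) * (q * s)

-- (A, C; C, B) is the Gram matrix of (Rs, q) and (Rq, s).  From the equations, (R² + 1)(s ± q)² = A + B ± 2C
-- and (R² − 1)(s² − q²) = A − B, so that (R² − 1)/(R² + 1) = (A − B)/D with D² = (A + B)² − 4C².
factorise : ∀ A B C → 0ℝ < A → 0ℝ < B → 0ℝ < C → 0ℝ < A * B - C * C → Factorisation A B C
factorise A B C 0<A 0<B 0<C 0<det = record
  { R = R ; s = s ; q = q ; 0<R = 0<R ; 0<q = 0<q ; q<s = 0<-⇒< 0<s-q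
  ; A≈ = ≈-sym A≈ ; B≈ = ≈-sym B≈ ; C≈ = ≈-sym C≈ }
  where
  open ℝ-Solver
  two : ∀ {n} → Polynomial n
  two = con (1ℚ ℚ.+ 1ℚ)
  U V E : ℝ
  U = A + B - 2ℝ * C
  V = A + B + 2ℝ * C
  E = A - B
  0<V : 0ℝ < V
  0<V = 0<x+y (0<x+y 0<A 0<B) (0<x*y 0<2 0<C)
  -- U V = 4(AB - C²) + (A - B)² is positive by the determinant condition.
  0<U : 0ℝ < U
  0<U = 0<x*y⇒0<y 0<V (0<-resp-≈ (solve 3 (λ A B C →
      two :* two :* (A :* B :- C :* C) :+ (A :- B) :* (A :- B) := (A :+ B :+ two :* C) :* (A :+ B :- two :* C))
      ≈-refl A B C)
    (0<x+nonneg (0<x*y (0<x*y 0<2 0<2) 0<det) (0≮-x² E)))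
  u = proj₁ (sqrt U 0<U)
  0<u = proj₁ (proj₂ (sqrt U 0<U))
  u²≈U = proj₂ (proj₂ (sqrt U 0<U))
  v = proj₁ (sqrt V 0<V)
  0<v = proj₁ (proj₂ (sqrt V 0<V))
  v²≈V = proj₂ (proj₂ (sqrt V 0<V))
  D : ℝ
  D = u * v
  0<D : 0ℝ < D
  0<D = 0<x*y 0<u 0<v
  -- The determinant is positive, so |E| < D and the quotient R² = (D + E)/(D - E) is defined and
  -- positive.
  D²-E² : (D + E) * (D - E) ≈ 2ℝ * 2ℝ * (A * B - C * C)
  D²-E² = ≈-trans (solve 3 (λ u v E → (u :* v :+ E) :* (u :* v :- E) := u :* u :* (v :* v) :- E :* E) ≈-refl u v E)
    (≈-trans (+-cong (*-cong u²≈U v²≈V) ≈-refl)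
      (solve 3 (λ A B C → (A :+ B :- two :* C) :* (A :+ B :+ two :* C) :- (A :- B) :* (A :- B)
        := two :* two :* (A :* B :- C :* C)) ≈-refl A B C))
  0<D±E : 0ℝ < D + E × 0ℝ < D - E
  0<D±E = 0<x+y∧0<x*y⇒0<x×0<y
    (0<-resp-≈ (solve 2 (λ D E → D :+ D := (D :+ E) :+ (D :- E)) ≈-refl D E) (0<x+y 0<D 0<D))
    (0<-resp-≈ (≈-sym D²-E²) (0<x*y (0<x*y 0<2 0<2) 0<det))
  0<D+E = proj₁ 0<D±E
  0<D-E = proj₂ 0<D±E
  0<2D : 0ℝ < 2ℝ * D
  0<2D = 0<x*y 0<2 0<D
  quotient : ∀ x y → 0ℝ < x → (0<y : 0ℝ < y) → Σ ℝ λ z → 0ℝ < z × z * z * y ≈ x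
  quotient x y 0<x 0<y = let z , 0<z , z²≈ = sqrt (x * inv y 0<y) (0<x*y 0<x (0<inv y 0<y)) in
    z , 0<z , ≈-trans (*-cong z²≈ ≈-refl) (≈-trans
      (solve 3 (λ x i y → x :* i :* y := x :* (y :* i)) ≈-refl x (inv y 0<y) y)
      (≈-trans (*-cong ≈-refl (x*inv≈1 y 0<y)) (ℝ-Ring.*-identityʳ x)))
  R = proj₁ (quotient (D + E) (D - E) 0<D+E 0<D-E)
  0<R = proj₁ (proj₂ (quotient (D + E) (D - E) 0<D+E 0<D-E))
  R²≈ : R * R * (D - E) ≈ D + E
  R²≈ = proj₂ (proj₂ (quotient (D + E) (D - E) 0<D+E 0<D-E))
  -- R² + 1 = 2D/(D - E), so `k` is the reciprocal of the square root of R² + 1.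
  k = proj₁ (quotient (D - E) (2ℝ * D) 0<D-E 0<2D)
  0<k = proj₁ (proj₂ (quotient (D - E) (2ℝ * D) 0<D-E 0<2D))
  k²≈ : k * k * (2ℝ * D) ≈ D - E
  k²≈ = proj₂ (proj₂ (quotient (D - E) (2ℝ * D) 0<D-E 0<2D))
  -- Solved from s + q = k v and s - q = k u. Then q > 0 comes from v² - u² = 4C > 0, and s > q from
  -- k u > 0.
  s q : ℝ
  s = ½ℝ * (k * (v + u))
  q = ½ℝ * (k * (v - u))
  0<½ℝ : 0ℝ < ½ℝ
  0<½ℝ = 0<-intro ½ℝ ½ 0 0<½ λ _ _ → ℚ.≤-refl
  0<v-u : 0ℝ < v - u
  0<v-u = 0<x*y⇒0<y (0<x+y 0<v 0<u) (0<-resp-≈ (≈-sym (≈-trans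
      (solve 2 (λ u v → (v :+ u) :* (v :- u) := v :* v :- u :* u) ≈-refl u v)
      (≈-trans (+-cong v²≈V (-‿cong u²≈U)) (solve 3 (λ A B C → (A :+ B :+ two :* C) :- (A :+ B :- two :* C)
        := two :* two :* C) ≈-refl A B C))))
    (0<x*y (0<x*y 0<2 0<2) 0<C))
  0<q : 0ℝ < q
  0<q = 0<x*y 0<½ℝ (0<x*y 0<k 0<v-u)
  0<s-q : 0ℝ < s - q
  0<s-q = 0<-resp-≈ (solve 3 (λ k u v → k :* u := con ½ :* (k :* (v :+ u)) :- con ½ :* (k :* (v :- u))) ≈-refl k u v)
    (0<x*y 0<k 0<u)
  k²[R²+1]≈1 : k * k * (R * R + 1ℝ) ≈ 1ℝ
  k²[R²+1]≈1 = *-cancelˡ 0<2D (≈-trans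
    (solve 3 (λ k R D → two :* D :* (k :* k :* (R :* R :+ con 1ℚ)) := k :* k :* (two :* D) :* (R :* R :+ con 1ℚ))
      ≈-refl k R D)
    (≈-trans (*-cong k²≈ ≈-refl) (≈-trans
      (solve 3 (λ R D E → (D :- E) :* (R :* R :+ con 1ℚ) := R :* R :* (D :- E) :+ (D :- E)) ≈-refl R D E)
      (≈-trans (+-cong R²≈ ≈-refl) (solve 2 (λ D E → (D :+ E) :+ (D :- E) := two :* D :* con 1ℚ) ≈-refl D E)))))
  k²[R²-1]D≈E : k * k * (R * R - 1ℝ) * (u * v) ≈ E
  k²[R²-1]D≈E = *-cancelˡ 0<2 (≈-trans
    (solve 3 (λ k R D → two :* (k :* k :* (R :* R :- con 1ℚ) :* D) := k :* k :* (two :* D) :* (R :* R :- con 1ℚ))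
      ≈-refl k R D)
    (≈-trans (*-cong k²≈ ≈-refl) (≈-trans
      (solve 3 (λ R D E → (D :- E) :* (R :* R :- con 1ℚ) := R :* R :* (D :- E) :- (D :- E)) ≈-refl R D E)
      (≈-trans (+-cong R²≈ ≈-refl) (solve 2 (λ D E → (D :+ E) :- (D :- E) := two :* E) ≈-refl D E)))))
  A≈ : R * R * (s * s) + q * q ≈ A
  A≈ = ≈-trans
    (solve 4 (λ k R u v → let s = con ½ :* (k :* (v :+ u)) ; q = con ½ :* (k :* (v :- u)) in
      R :* R :* (s :* s) :+ q :* q := con (½ ℚ.* ½) :* (k :* k :* (R :* R :+ con 1ℚ) :* (v :* v :+ u :* u)
        :+ two :* (k :* k :* (R :* R :- con 1ℚ) :* (u :* v)))) ≈-refl k R u v)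
    (≈-trans (*-cong ≈-refl (+-cong (*-cong k²[R²+1]≈1 (+-cong v²≈V u²≈U)) (*-cong ≈-refl k²[R²-1]D≈E)))
      (solve 3 (λ A B C → con (½ ℚ.* ½) :* (con 1ℚ :* ((A :+ B :+ two :* C) :+ (A :+ B :- two :* C))
        :+ two :* (A :- B)) := A) ≈-refl A B C))
  B≈ : R * R * (q * q) + s * s ≈ B
  B≈ = ≈-trans
    (solve 4 (λ k R u v → let s = con ½ :* (k :* (v :+ u)) ; q = con ½ :* (k :* (v :- u)) in
      R :* R :* (q :* q) :+ s :* s := con (½ ℚ.* ½) :* (k :* k :* (R :* R :+ con 1ℚ) :* (v :* v :+ u :* u)
        :- two :* (k :* k :* (R :* R :- con 1ℚ) :* (u :* v)))) ≈-refl k R u v)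
    (≈-trans (*-cong ≈-refl (+-cong (*-cong k²[R²+1]≈1 (+-cong v²≈V u²≈U)) (-‿cong (*-cong ≈-refl k²[R²-1]D≈E))))
      (solve 3 (λ A B C → con (½ ℚ.* ½) :* (con 1ℚ :* ((A :+ B :+ two :* C) :+ (A :+ B :- two :* C))
        :- two :* (A :- B)) := B) ≈-refl A B C))
  C≈ : (R * R + 1ℝ) * (q * s) ≈ C
  C≈ = ≈-trans
    (solve 4 (λ k R u v → let s = con ½ :* (k :* (v :+ u)) ; q = con ½ :* (k :* (v :- u)) in
      (R :* R :+ con 1ℚ) :* (q :* s) := con (½ ℚ.* ½) :* (k :* k :* (R :* R :+ con 1ℚ) :* (v :* v :- u :* u)))
      ≈-refl k R u v)
    (≈-trans (*-cong ≈-refl (*-cong k²[R²+1]≈1 (+-cong v²≈V (-‿cong u²≈U))))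
      (solve 3 (λ A B C → con (½ ℚ.* ½) :* (con 1ℚ :* ((A :+ B :+ two :* C) :- (A :+ B :- two :* C))) := C)
        ≈-refl A B C))

-- Put Δ = (s² - q²)². The Gram determinant is AB - C² = R²Δ, and A² + B² - 2C² = (A - B)² + 2(AB -
-- C²) = (R⁴ + 1)Δ, so both terms are R²(R⁴ + 1)Δ up to sign.
quartic : ∀ R s q → let A = R * R * (s * s) + q * q
                        B = R * R * (q * q) + s * s
                        C = (R * R + 1ℝ) * (q * s) in
  (A * B - C * C) * (R ^ 4 + 1ℝ) + (2ℝ * (C * C) - B * B - A * A) * R ^ 2 ≈ 0ℝ
quartic = solve 3 (λ R s q → let A = R :* R :* (s :* s) :+ q :* q
                                 B = R :* R :* (q :* q) :+ s :* s
                                 C = (R :* R :+ con 1ℚ) :* (q :* s) in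
  (A :* B :- C :* C) :* (R :^ 4 :+ con 1ℚ) :+ (con (1ℚ ℚ.+ 1ℚ) :* (C :* C) :- B :* B :- A :* A) :* R :^ 2
  := con 0ℚ) ≈-refl
  where open ℝ-Solver

-- The circle theorem

open GraphExpansion using (Z-cong; F[z]≈Z; F≈F[1])
open Exp ℝ-Ring.semiring using (^-congˡ; ^-homo-*)
open CommExp ℝ-Ring.commutativeSemiring using (^-distrib-*)
module ℂ^ = RawSemiringOps (RawRing.rawSemiring ℂ-rawRing)

fromℝ-^ : ∀ x n → fromℝ (x ^ n) ≈ᶜ fromℝ x ℂ^.^ n
fromℝ-^ x zero    = C.refl
fromℝ-^ x (suc n) = C.trans (fromℝ-* x (x ^ n)) (C.*-congˡ (fromℝ-^ x n))

module CircleTheorem (R s q κ : ℝ) (0<R : 0ℝ < R) (0<q : 0ℝ < q) (q<s : q < s) (0<κ : 0ℝ < κ) where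

  α β : Fin 2 → ℝ
  α 0F = s
  α 1F = q
  β 0F = q
  β 1F = s

  -- Both states carry the same `κ`, because the Lee-Yang induction starts from vertex weights
  -- independent of the state; `Z≈F` reduces unequal `μ` to this case.
  weights : ∀ d → Vector ℝ (suc d)
  weights d k = GraphExpansion.∑-list ℝ-commutativeRing (allFin 2) λ i → κ * ((R * α i) ^ (d ∸ toℕ k) * β i ^ toℕ k)

  private
    αᶜ βᶜ Rα : Fin 2 → ℂ
    αᶜ i = fromℝ (α i)
    βᶜ i = fromℝ (β i)
    Rα i = fromℝ (R * α i)

    ω : ℂ
    ω = fromℝ R C.* fromℝ R

    module Inside = LeeYang α β 0F 1F (λ f → C.+-congˡ (C.+-identityʳ (f 1F))) ≈-refl ≈-refl 0<q q<s κ 0<κ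
    module Outside = LeeYang β α 1F 0F
      (λ f → C.trans (C.+-congˡ (C.+-identityʳ (f 1F))) (C.+-comm (f 0F) (f 1F))) ≈-refl ≈-refl 0<q q<s κ 0<κ

    fromℝ-term : ∀ i m k → fromℝ (κ * ((R * α i) ^ m * β i ^ k)) ≈ᶜ fromℝ κ C.* (Rα i ℂ^.^ m C.* βᶜ i ℂ^.^ k)
    fromℝ-term i m k = C.trans (fromℝ-* κ _) (C.*-congˡ (C.trans (fromℝ-* _ _)
      (C.*-cong (fromℝ-^ (R * α i) m) (fromℝ-^ (β i) k))))

    fromℝ-weights : ∀ d k → fromℝ (weights d k) ≈ᶜ
      ∑-list (allFin 2) λ i → fromℝ κ C.* (Rα i ℂ^.^ (d ∸ toℕ k) C.* βᶜ i ℂ^.^ toℕ k)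
    fromℝ-weights d k = C.trans (fromℝ-+ _ _) (C.+-cong (fromℝ-term 0F (d ∸ toℕ k) (toℕ k))
      (C.trans (fromℝ-+ _ _) (C.+-congʳ (fromℝ-term 1F (d ∸ toℕ k) (toℕ k)))))

    norm²-z^2 : ∀ z → norm² (z ℂ^.^ 2) ≈ norm² z * norm² z
    norm²-z^2 z = ≈-trans (norm²-cong (C.*-congˡ (C.*-identityʳ z))) (norm²-* z z)

    norm²-ω : norm² ω ≈ R * R * (R * R)
    norm²-ω = ≈-trans (norm²-* (fromℝ R) (fromℝ R)) (*-cong (norm²-fromℝ R) (norm²-fromℝ R))

    -- The Lee-Yang variables are z² and R², so their squared moduli compare |z|⁴ with R⁴, whereas
    -- the position of `z` is known through |z|² and R².
    difference-of-squares : ∀ {x y} → 0ℝ < x - y → 0ℝ < x + y → 0ℝ < x * x - y * y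
    difference-of-squares {x} {y} p q = 0<-resp-≈
      (solve 2 (λ x y → (x :- y) :* (x :+ y) := x :* x :- y :* y) ≈-refl x y) (0<x*y p q)
      where open ℝ-Solver

    0<R²+∣z∣² : ∀ z → 0ℝ < R * R + norm² z
    0<R²+∣z∣² z = 0<x+nonneg (0<x*y 0<R 0<R) (0≮-norm² z)

  zerosOnCircle : ∀ {d} (G : Graph) (reg : Regular d G) → ZerosOnCircle G reg (weights d) R
  zerosOnCircle {d} G reg z F≈0 = ≈-trans
      (solve 2 (λ a b → a :^ 2 :+ b :^ 2 := a :* a :+ b :* b) ≈-refl (re z) (im z))
      (≈-trans (x-y≈0⇒x≈y (tight ¬outside ¬inside)) (*-cong ≈-refl (≈-sym (ℝ-Ring.*-identityʳ R))))
    where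
    open ℝ-Solver
    Z≈0 : ∀ {N} → (∀ i j → Rα i C.* Rα j C.+ z ℂ^.^ 2 C.* (βᶜ i C.* βᶜ j) ≈ᶜ N i j) →
      GraphPolynomials.Z ℂ-rawRing G N (λ _ → fromℝ κ) ≈ᶜ C.0#
    Z≈0 N≈ = C.trans (C.sym (C.trans
      (F[z]≈Z ℂ-commutativeRing G reg (λ k → fromℝ (weights d k)) (λ _ → fromℝ κ) Rα βᶜ (fromℝ-weights d) z)
      (Z-cong ℂ-commutativeRing G (λ _ → fromℝ κ) N≈))) F≈0
    scale : ∀ i j → Rα i C.* Rα j ≈ᶜ ω C.* (αᶜ i C.* αᶜ j)
    scale i j = C.trans (C.*-cong (fromℝ-* R (α i)) (fromℝ-* R (α j)))
      (K.solve 3 (λ r a b → (r K.:* a) K.:* (r K.:* b) K.:= (r K.:* r) K.:* (a K.:* b)) C.refl (fromℝ R) (αᶜ i) (αᶜ j))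
      where module K = ℂ-Solver
    ¬inside : ¬ 0ℝ < - (norm² z - R * R)
    -- For the constant vertex weight `κ`, `partition` over the edges of `G` unfolds to `Z`, so a
    -- zero of F contradicts Lee-Yang at (ω : w) = (R² : z²).
    ¬inside p = Inside.partition-≉0 (Graph.size G) (Graph.edge G) (λ _ _ → fromℝ κ) (λ _ → inj₂ λ _ → C.refl)
      (z ℂ^.^ 2) ω
      (0<-⇒< (0<-resp-≈ (+-cong (≈-sym norm²-ω) (-‿cong (≈-sym (norm²-z^2 z))))
        (difference-of-squares (0<-resp-≈ (solve 2 (λ m r → :- (m :- r) := r :- m) ≈-refl (norm² z) (R * R)) p)
          (0<R²+∣z∣² z))))
      (Z≈0 λ i j → C.+-congʳ (scale i j))
    ¬outside : ¬ 0ℝ < norm² z - R * R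
    -- Exchanging `α` with `β` and the two states replaces (R² : z²) by (z² : R²), which is
    -- admissible for |z| > R.
    ¬outside p = Outside.partition-≉0 (Graph.size G) (Graph.edge G) (λ _ _ → fromℝ κ) (λ _ → inj₂ λ _ → C.refl)
      ω (z ℂ^.^ 2)
      (0<-⇒< (0<-resp-≈ (+-cong (≈-sym (norm²-z^2 z)) (-‿cong (≈-sym norm²-ω)))
        (difference-of-squares p (0<-resp-≈ (ℝ-Ring.+-comm (R * R) (norm² z)) (0<R²+∣z∣² z)))))
      (Z≈0 λ i j → C.trans (C.+-congʳ (scale i j)) (C.+-comm _ _))

  -- A change of gauge: the vertex factor τᵢ^d is split among the d incident edges.
  Z≈F : ∀ {d} (G : Graph) (reg : Regular d G) (N : Matrix 2) (μ τ : Fin 2 → ℝ) →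
    (∀ i → μ i * τ i ^ d ≈ κ) →
    (∀ i j → N i j ≈ τ i * τ j * (R * R * (α i * α j) + β i * β j)) →
    Z G N μ ≈ F G reg (weights d)
  Z≈F {d} G reg N μ τ μτ^d≈κ N≈ = ≈-sym (≈-trans
    (F≈F[1] ℝ-commutativeRing G reg (weights d) μ a b weights≈)
    (≈-trans (F[z]≈Z ℝ-commutativeRing G reg (weights d) μ a b weights≈ 1ℝ)
      (Z-cong ℝ-commutativeRing G μ λ i j → ≈-sym (≈-trans (N≈ i j) (expand (τ i) (τ j) (α i) (α j) (β i) (β j))))))
    where
    open ℝ-Solver
    a b : Fin 2 → ℝ
    a i = R * α i * τ i
    b i = β i * τ i
    expand : ∀ t t′ a a′ b b′ → t * t′ * (R * R * (a * a′) + b * b′) ≈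
      R * a * t * (R * a′ * t′) + 1ℝ ^ 2 * (b * t * (b′ * t′))
    expand t t′ a a′ b b′ = solve 7 (λ R t t′ a a′ b b′ → t :* t′ :* (R :* R :* (a :* a′) :+ b :* b′) :=
      R :* a :* t :* (R :* a′ :* t′) :+ con 1ℚ :^ 2 :* (b :* t :* (b′ :* t′))) ≈-refl R t t′ a a′ b b′
    term : ∀ i m k → m ℕ.+ k ≡ d → κ * ((R * α i) ^ m * β i ^ k) ≈ μ i * (a i ^ m * b i ^ k)
    term i m k m+k≡d = ≈-sym (≈-trans
      (*-cong ≈-refl (*-cong (^-distrib-* (R * α i) (τ i) m) (^-distrib-* (β i) (τ i) k)))
      (≈-trans (solve 5 (λ μ x y z w → μ :* (x :* y :* (z :* w)) := μ :* (y :* w) :* (x :* z)) ≈-refl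
          (μ i) ((R * α i) ^ m) (τ i ^ m) (β i ^ k) (τ i ^ k))
        (*-cong (≈-trans (*-cong ≈-refl (≈-trans (≈-sym (^-homo-* (τ i) m k))
          (ℝ-Ring.reflexive (≡.cong (τ i ^_) m+k≡d)))) (μτ^d≈κ i)) ≈-refl)))
    weights≈ : ∀ k → weights d k ≈ GraphExpansion.∑-list ℝ-commutativeRing (allFin 2) λ i →
      μ i * (a i ^ (d ∸ toℕ k) * b i ^ toℕ k)
    weights≈ k = GraphExpansion.∑-list-cong ℝ-commutativeRing (allFin 2) λ i →
      term i (d ∸ toℕ k) (toℕ k) (ℕ.m∸n+n≡m (ℕ.s≤s⁻¹ (Fin.toℕ<n k)))

-- From positive definite matrices to the circle theorem

det>0 : ∀ (N : Matrix 2) → Symmetric N → PositiveDefinite N → (∀ i j → 0ℝ < N i j) →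
  0ℝ < N 0F 0F * N 1F 1F - N 0F 1F ^ 2
det>0 N symm posdef N>0 = 0<x*y⇒0<y (N>0 0F 0F) (0<-resp-≈
  (≈-trans (+-cong ≈-refl (+-cong (+-cong (*-cong (*-cong ≈-refl (symm 1F 0F)) ≈-refl) ≈-refl) ≈-refl))
    (solve 3 (λ p o r →
      (o :* p :* o :+ (o :* o :* (:- p) :+ con 0ℚ)) :+ (((:- p) :* o :* o :+ ((:- p) :* r :* (:- p) :+ con 0ℚ)) :+ con 0ℚ)
      := p :* (p :* r :- o :^ 2)) ≈-refl (N 0F 0F) (N 0F 1F) (N 1F 1F)))
  (posdef v (0F , inj₂ (N>0 0F 1F))))
  where
  open ℝ-Solver
  -- Chosen orthogonal to the first row: N v = (0, -det N), so the quadratic form takes the value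
  -- N₀₀ det N.
  v : Vector ℝ 2
  v 0F = N 0F 1F
  v 1F = - N 0F 0F

1^n≈1 : ∀ n → 1ℝ ^ n ≈ 1ℝ
1^n≈1 zero    = ≈-refl
1^n≈1 (suc n) = ≈-trans (ℝ-Ring.*-identityˡ (1ℝ ^ n)) (1^n≈1 n)

CircleProperty : (d : ℕ) (N : Matrix 2) (μ : Vector ℝ 2) → (∀ i → 0ℝ < μ i) → Set
CircleProperty d N μ μ>0 =
    Σ (Vector ℝ (suc d)) λ vc → Σ ℝ λ Rc →
    0ℝ < Rc ×
    ((G : Graph) (reg : Regular d G) → Z G N μ ≈ F G reg vc × ZerosOnCircle G reg vc Rc) ×
    (Σ ℝ λ T → Σ (T IsPower (μ 1F * inv (μ 0F) (μ>0 0F)) [ 2 / d ]) λ isT →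
    (N 0F 0F * N 1F 1F - N 0F 1F ^ 2) * Rc ^ 4
    + (- (N 1F 1F ^ 2 * T) + 2ℝ * N 0F 1F ^ 2 - N 0F 0F ^ 2 * inv T (power>0 isT)) * Rc ^ 2
    + (N 0F 0F * N 1F 1F - N 0F 1F ^ 2)
    ≈ 0ℝ)

-- The matrix behind this expression is D N D with D = diag(1, t); its determinant is t² det N.
scaled-det : ∀ p o r t → 0ℝ < t → 0ℝ < p * r - o ^ 2 → 0ℝ < p * (t * t * r) - t * o * (t * o)
scaled-det p o r t 0<t 0<det = 0<-resp-≈
  (solve 4 (λ p o r t → t :* t :* (p :* r :- o :^ 2) := p :* (t :* t :* r) :- t :* o :* (t :* o)) ≈-refl p o r t)
  (0<x*y (0<x*y 0<t 0<t) 0<det)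
  where open ℝ-Solver

-- With D = diag(1, t), passing from N to D N D divides the second vertex weight by t^d, because d
-- edges meet at every vertex; as t^d = μ₁/μ₀, both weights become μ₀. The factorisation is that of
-- D N D, and `τ` = (1, t⁻¹) undoes D. The `T` of the equation is t².
factorisation⇒circleProperty : ∀ d N → Symmetric N → ∀ μ (μ>0 : ∀ i → 0ℝ < μ i) t → 0ℝ < t →
  t ^ d ≈ μ 1F * inv (μ 0F) (μ>0 0F) →
  Factorisation (N 0F 0F) (t * t * N 1F 1F) (t * N 0F 1F) → CircleProperty d N μ μ>0
factorisation⇒circleProperty d N symm μ μ>0 t 0<t t^d≈ratio factorisation =
  weights d , R , 0<R , (λ G reg → Z≈F G reg N μ τ μτ^d≈μ₀ N≈ , zerosOnCircle G reg) ,
  t * t , isPower 0<T T^d≈ , equation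
  where
  open ℝ-Solver
  p o r ratio : ℝ
  p = N 0F 0F
  o = N 0F 1F
  r = N 1F 1F
  ratio = μ 1F * inv (μ 0F) (μ>0 0F)
  0<T : 0ℝ < t * t
  0<T = 0<x*y 0<t 0<t
  T^d≈ : (t * t) ^ d ≈ ratio ^ 2
  T^d≈ = ≈-trans (^-distrib-* t t d) (≈-trans (*-cong t^d≈ratio t^d≈ratio)
    (*-cong ≈-refl (≈-sym (ℝ-Ring.*-identityʳ ratio))))
  open Factorisation factorisation
  open CircleTheorem R s q (μ 0F) 0<R 0<q q<s (μ>0 0F)
  t⁻¹ = inv t 0<t
  τ : Fin 2 → ℝ
  τ 0F = 1ℝ
  τ 1F = t⁻¹
  μτ^d≈μ₀ : ∀ i → μ i * τ i ^ d ≈ μ 0F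
  μτ^d≈μ₀ 0F = ≈-trans (*-cong ≈-refl (1^n≈1 d)) (ℝ-Ring.*-identityʳ (μ 0F))
  μτ^d≈μ₀ 1F = ≈-trans (*-cong μ₁≈ ≈-refl) (≈-trans (ℝ-Ring.*-assoc (μ 0F) (t ^ d) (t⁻¹ ^ d))
    (≈-trans (*-cong ≈-refl (≈-trans (≈-sym (^-distrib-* t t⁻¹ d)) (≈-trans (^-congˡ d (x*inv≈1 t 0<t)) (1^n≈1 d))))
      (ℝ-Ring.*-identityʳ (μ 0F))))
    where
    μ₁≈ : μ 1F ≈ μ 0F * t ^ d
    μ₁≈ = ≈-sym (≈-trans (*-cong ≈-refl t^d≈ratio) (≈-trans
      (solve 3 (λ a b i → a :* (b :* i) := b :* (a :* i)) ≈-refl (μ 0F) (μ 1F) (inv (μ 0F) (μ>0 0F)))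
      (≈-trans (*-cong ≈-refl (x*inv≈1 (μ 0F) (μ>0 0F))) (ℝ-Ring.*-identityʳ (μ 1F)))))
  cancel : ∀ x → t⁻¹ * (t * x) ≈ x
  cancel x = ≈-trans (solve 3 (λ i t x → i :* (t :* x) := t :* i :* x) ≈-refl t⁻¹ t x)
    (≈-trans (*-cong (x*inv≈1 t 0<t) ≈-refl) (ℝ-Ring.*-identityˡ x))
  N₀₁≈ : o ≈ τ 0F * τ 1F * (R * R * (α 0F * α 1F) + β 0F * β 1F)
  N₀₁≈ = ≈-trans (≈-sym (cancel o)) (≈-trans (*-cong ≈-refl C≈)
    (solve 4 (λ i R s q → i :* ((R :* R :+ con 1ℚ) :* (q :* s)) := con 1ℚ :* i :* (R :* R :* (s :* q) :+ q :* s))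
      ≈-refl t⁻¹ R s q))
  N≈ : ∀ i j → N i j ≈ τ i * τ j * (R * R * (α i * α j) + β i * β j)
  N≈ 0F 0F = ≈-trans A≈ (solve 1 (λ x → x := con 1ℚ :* con 1ℚ :* x) ≈-refl (R * R * (s * s) + q * q))
  N≈ 0F 1F = N₀₁≈
  N≈ 1F 0F = ≈-trans (symm 1F 0F) (≈-trans N₀₁≈
    (solve 4 (λ i R s q → con 1ℚ :* i :* (R :* R :* (s :* q) :+ q :* s) := i :* con 1ℚ :* (R :* R :* (q :* s) :+ s :* q))
      ≈-refl t⁻¹ R s q))
  N≈ 1F 1F = ≈-trans (≈-sym (≈-trans
      (solve 3 (λ i t r → i :* i :* (t :* t :* r) := i :* (t :* (i :* (t :* r)))) ≈-refl t⁻¹ t r)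
      (≈-trans (cancel (t⁻¹ * (t * r))) (cancel r))))
    (*-cong ≈-refl B≈)
  equation : (p * r - o ^ 2) * R ^ 4
    + (- (r ^ 2 * (t * t)) + 2ℝ * o ^ 2 - p ^ 2 * inv (t * t) 0<T) * R ^ 2
    + (p * r - o ^ 2) ≈ 0ℝ
  -- Multiplying by T = t² clears the reciprocal of T and turns the coefficients into those of
  -- `quartic` for A = N₀₀, B = t² N₁₁, C = t N₀₁.
  equation = *-cancelˡ 0<T (≈-trans
    (solve 6 (λ p o r t i R →
      t :* t :* ((p :* r :- o :^ 2) :* R :^ 4
        :+ (:- (r :^ 2 :* (t :* t)) :+ con (1ℚ ℚ.+ 1ℚ) :* o :^ 2 :- p :^ 2 :* i) :* R :^ 2 :+ (p :* r :- o :^ 2))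
      := (p :* (t :* t :* r) :- t :* o :* (t :* o)) :* (R :^ 4 :+ con 1ℚ)
        :+ (con (1ℚ ℚ.+ 1ℚ) :* (t :* o :* (t :* o)) :- t :* t :* r :* (t :* t :* r) :- p :* p :* (t :* t :* i)) :* R :^ 2)
      ≈-refl p o r t (inv (t * t) 0<T) R)
    (≈-trans
      (+-cong (*-cong (+-cong (*-cong A≈ B≈) (-‿cong (*-cong C≈ C≈))) ≈-refl)
        (*-cong (+-cong (+-cong (*-cong ≈-refl (*-cong C≈ C≈)) (-‿cong (*-cong B≈ B≈)))
          (-‿cong (≈-trans (*-cong ≈-refl (x*inv≈1 (t * t) 0<T)) (≈-trans (ℝ-Ring.*-identityʳ (p * p)) (*-cong A≈ A≈)))))
          ≈-refl))
      (≈-trans (quartic R s q) (≈-sym (ℝ-Ring.zeroʳ (t * t))))))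

theorem3p15 : (d : ℕ) .{{_ : NonZero d}} →
    (N : Matrix 2) → Symmetric N → PositiveDefinite N → (∀ i j → 0ℝ < N i j) →
    (μ : Vector ℝ 2) (μ>0 : ∀ i → 0ℝ < μ i) →
    Σ (Vector ℝ (suc d)) λ vc → Σ ℝ λ Rc →
    0ℝ < Rc ×
    ((G : Graph) (reg : Regular d G) → Z G N μ ≈ F G reg vc × ZerosOnCircle G reg vc Rc) ×
    (Σ ℝ λ T → Σ (T IsPower (μ 1F * inv (μ 0F) (μ>0 0F)) [ 2 / d ]) λ isT →
    (N 0F 0F * N 1F 1F - N 0F 1F ^ 2) * Rc ^ 4
    + (- (N 1F 1F ^ 2 * T) + 2ℝ * N 0F 1F ^ 2 - N 0F 0F ^ 2 * inv T (power>0 isT)) * Rc ^ 2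
    + (N 0F 0F * N 1F 1F - N 0F 1F ^ 2)
    ≈ 0ℝ)
theorem3p15 d@(suc d-1) N symm posdef N>0 μ μ>0 =
  factorisation⇒circleProperty d N symm μ μ>0 root 0<root root^≈x
  (factorise (N 0F 0F) (root * root * N 1F 1F) (root * N 0F 1F)
    (N>0 0F 0F) (0<x*y (0<x*y 0<root 0<root) (N>0 1F 1F)) (0<x*y 0<root (N>0 0F 1F))
    (scaled-det (N 0F 0F) (N 0F 1F) (N 1F 1F) root 0<root (det>0 N symm posdef N>0)))
  -- `Root` takes the exponent less one, so `root` is the `d`-th root t of μ₁/μ₀.
  where open Root (μ 1F * inv (μ 0F) (μ>0 0F)) (0<x*y (μ>0 1F) (0<inv (μ 0F) (μ>0 0F))) d-1
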